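{- Let $\mathbf k\in(\mathbb N\cup\{\infty\})^\ell$. The ideal $\mathcal I\mathcal O^{\mathbf k}\subseteq\mathrm{NSym}^{(\ell)}$ is the two-sided ideal generated by $\{\Upsilon_{\mathbf n}:\mathbf 0<\mathbf n\le\mathbf k,\ |\mathbf n|\text{ even}\}$, and $\mathcal O^{\mathbf k}\subseteq\mathrm{QSym}^{(\ell)}$ is the $\mathbb Q$-span of those $\eta_{(\mathbf i_1,\dots,\mathbf i_m)}$ such that for every $r$, $\mathbf i_r\le\mathbf k$ implies $|\mathbf i_r|$ odd.
   Context: Fix $\ell\ge1$; $|\mathbf n|=\sum n_i$, coordinatewise order on $(\mathbb N\cup\{\infty\})^\ell$. Vector composition: sequence $\mathbf I=(\mathbf i_1,\dots,\mathbf i_m)$ of nonzero elements of $\mathbb N^\ell$, $\mathrm{len}(\mathbf I)=m$. $\mathbf J\trianglelefteq\mathbf I$ means $\mathbf J$ is obtained from $\mathbf I$ by adding together groups of consecutive columns. $\mathrm{QSym}^{(\ell)}$ is the $\mathbb Q$-span of $M_{\mathbf I}=\sum_{j_1<\dots<j_m}\mathbf x_{j_1}^{\mathbf i_1}\cdots\mathbf x_{j_m}^{\mathbf i_m}$ in commuting variables $x_j^{(i)}$ ($\mathbf x_j^{\mathbf n}=\prod_i(x_j^{(i)})^{n_i}$), a graded Hopf algebra with product of power series and deconcatenation coproduct; $\mathrm{NSym}^{(\ell)}$ is its graded dual. $\eta_{\mathbf I}=\sum_{\mathbf J\trianglelefteq\mathbf I}2^{\mathrm{len}(\mathbf J)}M_{\mathbf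 J}$ is a basis of $\mathrm{QSym}^{(\ell)}$, $(\Upsilon^{\mathbf I})$ is the dual basis of $\mathrm{NSym}^{(\ell)}$, and $\Upsilon_{\mathbf n}=\Upsilon^{(\mathbf n)}$. $\zeta_{\mathcal Q}(M_{\mathbf I})=1$ if $\mathrm{len}(\mathbf I)\le1$, else $0$; $\bar\zeta_{\mathcal Q}(h)=(-1)^{|\mathbf n|}\zeta_{\mathcal Q}(h)$ on degree $\mathbf n$; $\zeta_{\mathcal Q}^{ -1}$ the convolution inverse. $\mathcal I\mathcal O^{\mathbf k}$ is the ideal of $\mathrm{NSym}^{(\ell)}$ generated by $(\bar\zeta_{\mathcal Q})_{\mathbf n}-(\zeta_{\mathcal Q}^{ -1})_{\mathbf n}$ for $\mathbf n\le\mathbf k$ (subscript = restriction to degree $\mathbf n$). $\mathcal O^{\mathbf k}$ is the largest graded subcoalgebra $C$ of $\mathrm{QSym}^{(\ell)}$ with $\bar\zeta_{\mathcal Q}(h)=\zeta_{\mathcal Q}^{ -1}(h)$ for all $h\in C$ of degree $\le\mathbf k$. -}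

module Defs where

open import Data.Nat as ℕ using (ℕ; zero; suc; _%_; _^_)
open import Data.Bool using (Bool; true; false; T; not; _∧_; _∨_; if_then_else_)
open import Data.Integer using (+_)
open import Data.Rational using (ℚ; 0ℚ; 1ℚ; _+_; _*_; -_; _/_)
open import Data.Fin using (Fin)
open import Data.Vec using (Vec; []; _∷_; lookup; zipWith; replicate)
open import Data.List using (List; []; _∷_; _++_; length; map; foldr; concatMap)
open import Data.List.Relation.Unary.All using (All)
open import Data.Product using (Σ; ∃; _×_; _,_; proj₁; proj₂)
open import Data.Unit using (⊤)
open import Relation.Binary.PropositionalEquality using (_≡_; _≢_)
open import Function.Bundles using (_⇔_)

data ℕ∞ : Set where
  fin : ℕ → ℕ∞
  ∞   : ℕ∞

_≤∞_ : ℕ → ℕ∞ → Set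
m ≤∞ fin n = m ℕ.≤ n
m ≤∞ ∞     = ⊤

_≤ᵥ_ : ∀ {ℓ} → Vec ℕ ℓ → Vec ℕ∞ ℓ → Set
n ≤ᵥ k = ∀ i → lookup n i ≤∞ lookup k i

_+ᵥ_ : ∀ {ℓ} → Vec ℕ ℓ → Vec ℕ ℓ → Vec ℕ ℓ
_+ᵥ_ = zipWith ℕ._+_

0ᵥ : ∀ {ℓ} → Vec ℕ ℓ
0ᵥ = replicate _ 0

_=ᵥ_ : ∀ {ℓ} → Vec ℕ ℓ → Vec ℕ ℓ → Bool
[] =ᵥ [] = true
(x ∷ v) =ᵥ (y ∷ w) = (x ℕ.≡ᵇ y) ∧ (v =ᵥ w)

∣_∣ᵥ : ∀ {ℓ} → Vec ℕ ℓ → ℕ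
∣ [] ∣ᵥ = 0
∣ x ∷ v ∣ᵥ = x ℕ.+ ∣ v ∣ᵥ

nz? : ∀ {ℓ} → Vec ℕ ℓ → Bool
nz? [] = false
nz? (x ∷ v) = not (x ℕ.≡ᵇ 0) ∨ nz? v

NZ : ℕ → Set
NZ ℓ = Σ (Vec ℕ ℓ) (λ v → T (nz? v))

Comp : ℕ → Set
Comp ℓ = List (NZ ℓ)

len : ∀ {ℓ} → Comp ℓ → ℕ
len = length

deg : ∀ {ℓ} → Comp ℓ → Vec ℕ ℓ
deg = foldr (λ a acc → proj₁ a +ᵥ acc) 0ᵥ

_=ᶜ_ : ∀ {ℓ} → Comp ℓ → Comp ℓ → Bool
[] =ᶜ [] = true
(a ∷ I) =ᶜ (b ∷ J) = (proj₁ a =ᵥ proj₁ b) ∧ (I =ᶜ J)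
_ =ᶜ _ = false

-- J ⊴ I (J is obtained from I by adding together groups of consecutive
-- columns), decided by scanning I; acc is the sum of the currently open block.
coarsen-go : ∀ {ℓ} → Vec ℕ ℓ → Comp ℓ → Comp ℓ → Bool
coarsen-go acc [] [] = acc =ᵥ 0ᵥ
coarsen-go acc (_ ∷ _) [] = false
coarsen-go acc J (a ∷ I) =
  coarsen-go (acc +ᵥ proj₁ a) J I ∨ close J
  where
  close : _ → Bool
  close [] = false
  close (b ∷ J') = ((acc +ᵥ proj₁ a) =ᵥ proj₁ b) ∧ coarsen-go 0ᵥ J' I

_⊴ᵇ_ : ∀ {ℓ} → Comp ℓ → Comp ℓ → Bool
J ⊴ᵇ I = coarsen-go 0ᵥ J I

splits : ∀ {ℓ} → Comp ℓ → List (Comp ℓ × Comp ℓ)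
splits [] = ([] , []) ∷ []
splits (a ∷ I) = ([] , a ∷ I) ∷ map (λ ps → (a ∷ proj₁ ps , proj₂ ps)) (splits I)

nesplits : ∀ {ℓ} → Comp ℓ → List (Comp ℓ × Comp ℓ)
nesplits [] = []
nesplits (a ∷ I) = map (λ ps → (a ∷ proj₁ ps , proj₂ ps)) (splits I)

ℕ→ℚ : ℕ → ℚ
ℕ→ℚ n = (+ n) / 1

Σℚ : List ℚ → ℚ
Σℚ = foldr _+_ 0ℚ

δ : Bool → ℚ
δ b = if b then 1ℚ else 0ℚ

-- finite formal ℚ-linear combinations of basis vectors indexed by
-- vector compositions.  QSym^(ℓ) uses the basis (M_I); NSym^(ℓ) uses the
-- basis dual to (M_I) (written M*_I).

Lin : ℕ → Set
Lin ℓ = List (ℚ × Comp ℓ)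

QSym NSym : ℕ → Set
QSym = Lin
NSym = Lin

e : ∀ {ℓ} → Comp ℓ → Lin ℓ
e I = (1ℚ , I) ∷ []

coeff : ∀ {ℓ} → Lin ℓ → Comp ℓ → ℚ
coeff x I = Σℚ (map (λ qJ → proj₁ qJ * δ (proj₂ qJ =ᶜ I)) x)

_≈_ : ∀ {ℓ} → Lin ℓ → Lin ℓ → Set
x ≈ y = ∀ I → coeff x I ≡ coeff y I

_⊕_ : ∀ {ℓ} → Lin ℓ → Lin ℓ → Lin ℓ
_⊕_ = _++_

_·ₛ_ : ∀ {ℓ} → ℚ → Lin ℓ → Lin ℓ
c ·ₛ x = map (λ qJ → (c * proj₁ qJ , proj₂ qJ)) x

ΣLin : ∀ {ℓ} → List (Lin ℓ) → Lin ℓ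
ΣLin = foldr _⊕_ []

component : ∀ {ℓ} → Vec ℕ ℓ → Lin ℓ → Lin ℓ
component n x = map (λ qJ → (proj₁ qJ * δ (deg (proj₂ qJ) =ᵥ n) , proj₂ qJ)) x

Homogeneous : ∀ {ℓ} → Vec ℕ ℓ → Lin ℓ → Set
Homogeneous n x = ∀ I → coeff x I ≢ 0ℚ → deg I ≡ n

-- the η basis of QSym^(ℓ):  η_I = Σ_{J ⊴ I} 2^{len J} M_J ;
-- ηcoef I J is the coefficient of M_J in η_I

ηcoef : ∀ {ℓ} → Comp ℓ → Comp ℓ → ℚ
ηcoef I J = if J ⊴ᵇ I then ℕ→ℚ (2 ^ len J) else 0ℚ

-- NSym^(ℓ): product (dual to deconcatenation: M*_I M*_J = M*_{I·J}),
-- pairing with QSym^(ℓ), two-sided ideals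

_·_ : ∀ {ℓ} → NSym ℓ → NSym ℓ → NSym ℓ
x · y = concatMap (λ pI → map (λ qJ → (proj₁ pI * proj₁ qJ , proj₂ pI ++ proj₂ qJ)) y) x

⟪_,_⟫ : ∀ {ℓ} → NSym ℓ → QSym ℓ → ℚ
⟪ x , h ⟫ = Σℚ (concatMap (λ pI → map (λ qJ → proj₁ pI * proj₁ qJ * δ (proj₂ pI =ᶜ proj₂ qJ)) h) x)

⟪_,η_⟫ : ∀ {ℓ} → NSym ℓ → Comp ℓ → ℚ
⟪ x ,η J ⟫ = Σℚ (map (λ pI → proj₁ pI * ηcoef J (proj₂ pI)) x)

IsΥ : ∀ {ℓ} → Comp ℓ → NSym ℓ → Set
IsΥ I x = ∀ J → ⟪ x ,η J ⟫ ≡ δ (I =ᶜ J)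

InIdeal : ∀ {ℓ} → (NSym ℓ → Set) → NSym ℓ → Set
InIdeal {ℓ} P x =
  Σ (List (NSym ℓ × NSym ℓ × NSym ℓ)) λ L →
    All (λ t → P (proj₁ (proj₂ t))) L ×
    x ≈ ΣLin (map (λ t → (proj₁ t · proj₁ (proj₂ t)) · proj₂ (proj₂ t)) L)

SameIdeal : ∀ {ℓ} → (NSym ℓ → Set) → (NSym ℓ → Set) → Set
SameIdeal {ℓ} P Q = ∀ (x : NSym ℓ) → InIdeal P x ⇔ InIdeal Q x

-- linear functionals on QSym^(ℓ), given by their values on the M_I;
-- convolution inverse

Functional : ℕ → Set
Functional ℓ = Comp ℓ → ℚ

apply : ∀ {ℓ} → Functional ℓ → QSym ℓ → ℚ
apply φ h = Σℚ (map (λ qJ → proj₁ qJ * φ (proj₂ qJ)) h)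

_⋆_ : ∀ {ℓ} → Functional ℓ → Functional ℓ → Functional ℓ
(φ ⋆ ψ) I = Σℚ (map (λ ps → φ (proj₁ ps) * ψ (proj₂ ps)) (splits I))

εQ : ∀ {ℓ} → Functional ℓ
εQ [] = 1ℚ
εQ (_ ∷ _) = 0ℚ

-- convolution inverse of φ (with φ(1) = 1), defined by the recursion
-- expressing φ ⋆ φ⁻¹ = ε; fuel = length of the composition
inv-go : ∀ {ℓ} → Functional ℓ → ℕ → Functional ℓ
inv-go φ _ [] = 1ℚ
inv-go φ zero (_ ∷ _) = 0ℚ
inv-go φ (suc f) I@(_ ∷ _) =
  - Σℚ (map (λ ps → φ (proj₁ ps) * inv-go φ f (proj₂ ps)) (nesplits I))

_⁻¹⋆ : ∀ {ℓ} → Functional ℓ → Functional ℓ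
(φ ⁻¹⋆) I = inv-go φ (len I) I

ζQ : ∀ {ℓ} → Functional ℓ
ζQ [] = 1ℚ
ζQ (_ ∷ []) = 1ℚ
ζQ (_ ∷ _ ∷ _) = 0ℚ

sign : ℕ → ℚ
sign n = if n % 2 ℕ.≡ᵇ 0 then 1ℚ else - 1ℚ

ζ̄Q : ∀ {ℓ} → Functional ℓ
ζ̄Q I = sign ∣ deg I ∣ᵥ * ζQ I

-- the restriction φ_n of a functional to degree n, viewed as an element
-- of the graded dual NSym^(ℓ): x represents φ_n iff ⟨x , M_I⟩ = φ(M_I)
-- for deg I = n and 0 otherwise
IsRestriction : ∀ {ℓ} → Functional ℓ → Vec ℕ ℓ → NSym ℓ → Set
IsRestriction φ n x = ∀ I → coeff x I ≡ (if deg I =ᵥ n then φ I else 0ℚ)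

IOgen : ∀ {ℓ} → Vec ℕ∞ ℓ → NSym ℓ → Set
IOgen {ℓ} k x = Σ (Vec ℕ ℓ) λ n → n ≤ᵥ k × IsRestriction (λ I → ζ̄Q I + - (ζQ ⁻¹⋆) I) n x

Υgen : ∀ {ℓ} → Vec ℕ∞ ℓ → NSym ℓ → Set
Υgen {ℓ} k x = Σ (NZ ℓ) λ n → proj₁ n ≤ᵥ k × (∣ proj₁ n ∣ᵥ % 2 ≡ 0) × IsΥ (n ∷ []) x

Lin₂ : ℕ → Set
Lin₂ ℓ = List (ℚ × Comp ℓ × Comp ℓ)

coeff₂ : ∀ {ℓ} → Lin₂ ℓ → Comp ℓ → Comp ℓ → ℚ
coeff₂ x I J = Σℚ (map (λ t → proj₁ t * δ (proj₁ (proj₂ t) =ᶜ I) * δ (proj₂ (proj₂ t) =ᶜ J)) x)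

_≈₂_ : ∀ {ℓ} → Lin₂ ℓ → Lin₂ ℓ → Set
x ≈₂ y = ∀ I J → coeff₂ x I J ≡ coeff₂ y I J

_⊗_ : ∀ {ℓ} → Lin ℓ → Lin ℓ → Lin₂ ℓ
x ⊗ y = concatMap (λ pI → map (λ qJ → (proj₁ pI * proj₁ qJ , proj₂ pI , proj₂ qJ)) y) x

Δ : ∀ {ℓ} → QSym ℓ → Lin₂ ℓ
Δ h = concatMap (λ qI → map (λ ps → (proj₁ qI , proj₁ ps , proj₂ ps)) (splits (proj₂ qI))) h

InTensor : ∀ {ℓ} → (QSym ℓ → Set) → Lin₂ ℓ → Set
InTensor {ℓ} C t =
  Σ (List (QSym ℓ × QSym ℓ)) λ L →
    All (λ cd → C (proj₁ cd) × C (proj₂ cd)) L ×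
    t ≈₂ foldr (λ cd acc → (proj₁ cd ⊗ proj₂ cd) ++ acc) [] L

record IsGradedSubcoalgebra {ℓ} (C : QSym ℓ → Set) : Set where
  field
    respects≈  : ∀ x y → x ≈ y → C x → C y
    zero∈      : C []
    ⊕-closed   : ∀ x y → C x → C y → C (x ⊕ y)
    ·ₛ-closed  : ∀ c x → C x → C (c ·ₛ x)
    graded     : ∀ x n → C x → C (component n x)
    coalgebra  : ∀ x → C x → InTensor C (Δ x)

OCondition : ∀ {ℓ} → Vec ℕ∞ ℓ → (QSym ℓ → Set) → Set
OCondition {ℓ} k C =
  ∀ (h : QSym ℓ) (n : Vec ℕ ℓ) → C h → n ≤ᵥ k → Homogeneous n h →
    apply ζ̄Q h ≡ apply (ζQ ⁻¹⋆) h

Admissible : ∀ {ℓ} → Vec ℕ∞ ℓ → Comp ℓ → Set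
Admissible k I = All (λ a → proj₁ a ≤ᵥ k → ∣ proj₁ a ∣ᵥ % 2 ≡ 1) I

ηSpan : ∀ {ℓ} → Vec ℕ∞ ℓ → QSym ℓ → Set
ηSpan {ℓ} k h =
  Σ (List (ℚ × Comp ℓ)) λ L →
    All (λ qI → Admissible k (proj₂ qI)) L ×
    (∀ J → coeff h J ≡ Σℚ (map (λ qI → proj₁ qI * ηcoef (proj₂ qI) J) L))

{-# OPTIONS --safe #-}
-- A functional on QSym is determined by its values on the basis (η_I); the passage φ ↦ (I ↦ φ(η_I)) is
-- multiplicative for convolution, because the η_I deconcatenate like the M_I, and it is invertible, being
-- one of a family W p q of operators with W p q ∘ W p′ q′ = W (p p′) (p q′ + q).  In these coordinates
-- ζ̄ − ζ⁻¹ takes the value 2((−1)^|I| − (−1)^len I), which vanishes when all parts of I are odd, and Υ^I is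
-- the product of the Υ of the parts of I.  So the degree n generator of IO^k is a combination of the Υ^I with
-- an even part, in which Υ_n (|n| even) has coefficient 4; induction on |n| gives the equality of ideals.
-- The annihilator in NSym of a graded subcoalgebra C is a two-sided ideal; if C satisfies the defining condition
-- of O^k the annihilator contains IO^k, hence every Υ^I with I inadmissible, so C lies in the span of the
-- admissible η_I.

module Submission where

open import Defs
open import Data.Nat using (ℕ; _≤_)
open import Data.Vec using (Vec)
open import Data.Product using (_×_)

open import Data.Bool using (Bool; true; false; T; T?; _∧_; _∨_; if_then_else_)
open import Data.Bool.Properties using (T-irrelevant; ∨-identityʳ)
open import Data.Empty using (⊥-elim)
open import Data.Fin.Properties using (all?)
import Data.Integer as ℤ
import Data.Integer.Properties as ℤ
open import Data.List using (List; []; _∷_; _++_; length; map; foldr; concatMap; filter; upTo; cartesianProductWith)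
open import Data.List.Membership.Propositional using (_∈_; _∉_)
open import Data.List.Membership.Propositional.Properties using (∈-concatMap⁺; ∈-cartesianProductWith⁺; ∈-upTo⁺)
open import Data.List.Properties using (length-filter; ++-assoc; ++-identityʳ)
open import Data.List.Relation.Unary.All as All using (All; []; _∷_)
open import Data.List.Relation.Unary.All.Properties using (all-filter; map⁺; ++⁺)
open import Data.List.Relation.Unary.Any as Any using (here; there)
open import Data.Nat as ℕ using (zero; suc; z≤n; s≤s; _<_; _%_; _^_)
open import Data.Nat.DivMod using (m%n<n)
import Data.Nat.Properties as ℕ
open import Data.Product using (_,_; proj₁; proj₂)
open import Data.Rational using (ℚ; 0ℚ; 1ℚ; ½; _+_; _*_; -_; toℚᵘ)
open import Data.Rational.Properties as ℚ using (+-identityˡ; +-identityʳ; *-identityˡ; *-identityʳ; *-zeroˡ; *-zeroʳ; *-distribˡ-+; *-distribʳ-+; +-assoc; *-assoc)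
open import Data.Rational.Solver using (module +-*-Solver)
open import Data.Rational.Unnormalised using (mkℚᵘ; *≡*)
import Data.Rational.Unnormalised.Properties as ℚᵘ
open import Data.Sum as Sum using (_⊎_; inj₁; inj₂)
open import Data.Unit using (tt)
open import Data.Vec using ([]; _∷_; lookup)
import Data.Vec.Properties as Vec
open import Function using (_∘_)
open import Function.Bundles using (mk⇔)
open import Relation.Binary.PropositionalEquality using (_≡_; _≢_; _≗_; refl; sym; trans; cong; cong₂; subst; module ≡-Reasoning)
open import Relation.Nullary using (¬_; Dec; yes; no; ¬?; _×-dec_; _→-dec_)
open import Relation.Nullary.Decidable using (decidable-stable)
open import Relation.Unary using (Decidable)
open +-*-Solver using (solve; _:=_; _:+_; _:*_; :-_; con)
open ≡-Reasoning

-- A coarsening of `I` is an independent choice, at each gap between neighbouring columns, of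
-- keeping the gap or closing it. `W p q` gives weight `p` to a kept gap, weight `q` to a closed
-- one, and one further `p` to every nonempty composition. Multiplicativity for convolution, the
-- composition law and the closed formulas for `ζ̄Q` and `ζQ ⁻¹⋆` all come from this gap-by-gap
-- picture, and the recursions follow it by deciding the first gap. The shape of the rest is forced
-- by the representation. Elements of `QSym` and `NSym` are unnormalised lists compared through
-- their coefficients, whereas a functional has values on infinitely many compositions. Hence
-- evaluation has to be independent of the representing list, a functional becomes an element of
-- `NSym` only after restriction to one degree, and entries whose total coefficient is zero must be
-- filtered out before a condition on all entries of a list can hold.

variable
  A B : Set
  ℓ : ℕ

-- Finite sums

∑ : (A → ℚ) → List A → ℚ
∑ f xs = Σℚ (map f xs)

∑-cong : {f g : A → ℚ} → f ≗ g → ∀ xs → ∑ f xs ≡ ∑ g xs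
∑-cong f≗g [] = refl
∑-cong f≗g (x ∷ xs) = cong₂ _+_ (f≗g x) (∑-cong f≗g xs)

∑-zero : (xs : List A) → ∑ (λ _ → 0ℚ) xs ≡ 0ℚ
∑-zero [] = refl
∑-zero (x ∷ xs) = trans (+-identityˡ _) (∑-zero xs)

∑-++ : (f : A → ℚ) → ∀ xs ys → ∑ f (xs ++ ys) ≡ ∑ f xs + ∑ f ys
∑-++ f [] ys = sym (+-identityˡ _)
∑-++ f (x ∷ xs) ys = trans (cong (f x +_) (∑-++ f xs ys)) (sym (+-assoc (f x) _ _))

∑-map : (f : B → ℚ) (g : A → B) → ∀ xs → ∑ f (map g xs) ≡ ∑ (f ∘ g) xs
∑-map f g [] = refl
∑-map f g (x ∷ xs) = cong (f (g x) +_) (∑-map f g xs)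

∑-concatMap : (f : B → ℚ) (g : A → List B) → ∀ xs → ∑ f (concatMap g xs) ≡ ∑ (λ x → ∑ f (g x)) xs
∑-concatMap f g [] = refl
∑-concatMap f g (x ∷ xs) = trans (∑-++ f (g x) _) (cong (∑ f (g x) +_) (∑-concatMap f g xs))

+-interchange : ∀ a b c d → (a + b) + (c + d) ≡ (a + c) + (b + d)
+-interchange = solve 4 (λ a b c d → (a :+ b) :+ (c :+ d) := (a :+ c) :+ (b :+ d)) refl

∑-+ : (f g : A → ℚ) → ∀ xs → ∑ (λ x → f x + g x) xs ≡ ∑ f xs + ∑ g xs
∑-+ f g [] = refl
∑-+ f g (x ∷ xs) = trans (cong ((f x + g x) +_) (∑-+ f g xs)) (+-interchange (f x) (g x) _ _)

∑-*ˡ : ∀ c (f : A → ℚ) xs → ∑ (λ x → c * f x) xs ≡ c * ∑ f xs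
∑-*ˡ c f [] = sym (*-zeroʳ c)
∑-*ˡ c f (x ∷ xs) = trans (cong (c * f x +_) (∑-*ˡ c f xs)) (sym (*-distribˡ-+ c (f x) _))

-- Evaluating functionals on formal combinations

apply-cong : {φ ψ : Functional ℓ} → φ ≗ ψ → ∀ x → apply φ x ≡ apply ψ x
apply-cong φ≗ψ = ∑-cong λ (q , J) → cong (q *_) (φ≗ψ J)

apply-++ : (φ : Functional ℓ) → ∀ x y → apply φ (x ++ y) ≡ apply φ x + apply φ y
apply-++ φ = ∑-++ _

apply-·ₛ : (φ : Functional ℓ) → ∀ c x → apply φ (c ·ₛ x) ≡ c * apply φ x
apply-·ₛ φ c x = begin
  apply φ (c ·ₛ x) ≡⟨ ∑-map _ _ x ⟩
  ∑ (λ (q , J) → c * q * φ J) x ≡⟨ ∑-cong (λ (q , J) → *-assoc c q (φ J)) x ⟩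
  ∑ (λ (q , J) → c * (q * φ J)) x ≡⟨ ∑-*ˡ c _ x ⟩
  c * apply φ x ∎

apply-zero : ∀ (x : Lin ℓ) → apply (λ _ → 0ℚ) x ≡ 0ℚ
apply-zero x = trans (∑-cong (λ (q , _) → *-zeroʳ q) x) (∑-zero x)

apply-+ : (φ ψ : Functional ℓ) → ∀ x → apply (λ I → φ I + ψ I) x ≡ apply φ x + apply ψ x
apply-+ φ ψ x = trans (∑-cong (λ (q , J) → *-distribˡ-+ q (φ J) (ψ J)) x) (∑-+ _ _ x)

*-left-comm : ∀ a b c → a * (b * c) ≡ b * (a * c)
*-left-comm = solve 3 (λ a b c → a :* (b :* c) := b :* (a :* c)) refl

apply-*ˡ : ∀ c (φ : Functional ℓ) x → apply (λ I → c * φ I) x ≡ c * apply φ x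
apply-*ˡ c φ x = trans (∑-cong (λ (q , J) → *-left-comm q c (φ J)) x) (∑-*ˡ c _ x)

infixl 1 _>>=_
_>>=_ : Lin ℓ → (Comp ℓ → Lin ℓ) → Lin ℓ
x >>= f = concatMap (λ (q , I) → q ·ₛ f I) x

apply->>= : (φ : Functional ℓ) → ∀ x f → apply φ (x >>= f) ≡ apply (λ I → apply φ (f I)) x
apply->>= φ x f = trans (∑-concatMap _ _ x) (∑-cong (λ (q , I) → apply-·ₛ φ q (f I)) x)

-- Equality of vectors and compositions

=ᵥ-refl : (v : Vec ℕ ℓ) → (v =ᵥ v) ≡ true
=ᵥ-refl [] = refl
=ᵥ-refl (zero ∷ v) = =ᵥ-refl v
=ᵥ-refl (suc x ∷ v) = =ᵥ-refl (x ∷ v)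

=ᵥ-sound : (v w : Vec ℕ ℓ) → (v =ᵥ w) ≡ true → v ≡ w
=ᵥ-sound [] [] _ = refl
=ᵥ-sound (zero ∷ v) (zero ∷ w) eq = cong (0 ∷_) (=ᵥ-sound v w eq)
=ᵥ-sound (suc x ∷ v) (suc y ∷ w) eq with =ᵥ-sound (x ∷ v) (y ∷ w) eq
... | refl = refl

=ᵥ-complete : (v w : Vec ℕ ℓ) → v ≢ w → (v =ᵥ w) ≡ false
=ᵥ-complete v w v≢w with v =ᵥ w in eq
... | true = ⊥-elim (v≢w (=ᵥ-sound v w eq))
... | false = refl

_≟ᵥ_ : (v w : Vec ℕ ℓ) → Dec (v ≡ w)
v ≟ᵥ w with v =ᵥ w in eq
... | true = yes (=ᵥ-sound v w eq)
... | false = no λ { refl → case-absurd (trans (sym (=ᵥ-refl v)) eq) }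
  where
  case-absurd : true ≢ false
  case-absurd ()

NZ-≡ : {a b : NZ ℓ} → proj₁ a ≡ proj₁ b → a ≡ b
NZ-≡ {a = v , p} {.v , q} refl = cong (v ,_) (T-irrelevant p q)

=ᶜ-refl : (I : Comp ℓ) → (I =ᶜ I) ≡ true
=ᶜ-refl [] = refl
=ᶜ-refl (a ∷ I) rewrite =ᵥ-refl (proj₁ a) = =ᶜ-refl I

_≟ᶜ_ : (I J : Comp ℓ) → Dec (I ≡ J)
[] ≟ᶜ [] = yes refl
[] ≟ᶜ (_ ∷ _) = no λ ()
(_ ∷ _) ≟ᶜ [] = no λ ()
(a ∷ I) ≟ᶜ (b ∷ J) with proj₁ a ≟ᵥ proj₁ b | I ≟ᶜ J
... | yes p | yes q = yes (cong₂ _∷_ (NZ-≡ p) q)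
... | no ¬p | _ = no λ { refl → ¬p refl }
... | _ | no ¬q = no λ { refl → ¬q refl }

=ᶜ-complete : {I J : Comp ℓ} → I ≢ J → (I =ᶜ J) ≡ false
=ᶜ-complete {I = []} {[]} I≢J = ⊥-elim (I≢J refl)
=ᶜ-complete {I = []} {_ ∷ _} _ = refl
=ᶜ-complete {I = _ ∷ _} {[]} _ = refl
=ᶜ-complete {I = a ∷ I} {b ∷ J} I≢J with proj₁ a =ᵥ proj₁ b in eq
... | true = =ᶜ-complete {I = I} {J} λ { refl → I≢J (cong (_∷ I) (NZ-≡ (=ᵥ-sound _ _ eq))) }
... | false = refl

δ-refl : (I : Comp ℓ) → δ (I =ᶜ I) ≡ 1ℚ
δ-refl I = cong δ (=ᶜ-refl I)

δ-≢ : (I J : Comp ℓ) → I ≢ J → δ (I =ᶜ J) ≡ 0ℚ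
δ-≢ I J I≢J = cong δ (=ᶜ-complete {I = I} {J} I≢J)

δ-sym : (I J : Comp ℓ) → δ (I =ᶜ J) ≡ δ (J =ᶜ I)
δ-sym I J with I ≟ᶜ J
... | yes refl = refl
... | no I≢J = trans (δ-≢ I J I≢J) (sym (δ-≢ J I (I≢J ∘ sym)))

-- Evaluation depends only on coefficients

coeff-filter-yes : {P : Comp ℓ → Set} (P? : Decidable P) → ∀ {K} → P K → ∀ x → coeff (filter (P? ∘ proj₂) x) K ≡ coeff x K
coeff-filter-yes P? pK [] = refl
coeff-filter-yes P? {K} pK ((q , J) ∷ x) with P? J
... | yes _ = cong (q * δ (J =ᶜ K) +_) (coeff-filter-yes P? pK x)
... | no ¬pJ = begin
  coeff (filter (P? ∘ proj₂) x) K ≡⟨ coeff-filter-yes P? pK x ⟩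
  coeff x K ≡⟨ +-identityˡ _ ⟨
  0ℚ + coeff x K ≡⟨ cong (_+ coeff x K) (*-zeroʳ q) ⟨
  q * 0ℚ + coeff x K ≡⟨ cong (λ d → q * d + coeff x K) (δ-≢ J K λ { refl → ¬pJ pK }) ⟨
  q * δ (J =ᶜ K) + coeff x K ∎

coeff-filter-no : {P : Comp ℓ → Set} (P? : Decidable P) → ∀ {K} → ¬ P K → ∀ x → coeff (filter (P? ∘ proj₂) x) K ≡ 0ℚ
coeff-filter-no P? ¬pK [] = refl
coeff-filter-no P? {K} ¬pK ((q , J) ∷ x) with P? J
... | no _ = coeff-filter-no P? ¬pK x
... | yes pJ = begin
  q * δ (J =ᶜ K) + coeff (filter (P? ∘ proj₂) x) K ≡⟨ cong₂ (λ d c → q * d + c) (δ-≢ J K λ { refl → ¬pK pJ }) (coeff-filter-no P? ¬pK x) ⟩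
  q * 0ℚ + 0ℚ ≡⟨ trans (+-identityʳ _) (*-zeroʳ q) ⟩
  0ℚ ∎

-- Spans and ideals are witnessed by a condition on every entry of a list, but a list may mention a
-- composition whose coefficients cancel. This removes such entries without changing the element.
filter-≈ : {P : Comp ℓ → Set} (P? : Decidable P) → ∀ x → (∀ K → ¬ P K → coeff x K ≡ 0ℚ) → filter (P? ∘ proj₂) x ≈ x
filter-≈ P? x vanishes K with P? K
... | yes pK = coeff-filter-yes P? pK x
... | no ¬pK = trans (coeff-filter-no P? ¬pK x) (sym (vanishes K ¬pK))

_≢?_ : (I : Comp ℓ) → Decidable (I ≢_)
I ≢? J = ¬? (I ≟ᶜ J)

without : Comp ℓ → Lin ℓ → Lin ℓ
without I = filter ((I ≢?_) ∘ proj₂)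

apply-without : (φ : Functional ℓ) → ∀ I x → apply φ x ≡ coeff x I * φ I + apply φ (without I x)
apply-without φ I [] = sym (trans (+-identityʳ _) (*-zeroˡ (φ I)))
apply-without φ I ((q , J) ∷ x) with I ≟ᶜ J
... | yes refl = begin
  q * φ I + apply φ x ≡⟨ cong (q * φ I +_) (apply-without φ I x) ⟩
  q * φ I + (coeff x I * φ I + apply φ (without I x)) ≡⟨ solve 4 (λ q f c r → q :* f :+ (c :* f :+ r) := (q :* con 1ℚ :+ c) :* f :+ r) refl q (φ I) (coeff x I) _ ⟩
  (q * 1ℚ + coeff x I) * φ I + apply φ (without I x) ≡⟨ cong (λ d → (q * d + coeff x I) * φ I + apply φ (without I x)) (δ-refl I) ⟨
  (q * δ (I =ᶜ I) + coeff x I) * φ I + apply φ (without I x) ∎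
... | no I≢J = begin
  q * φ J + apply φ x ≡⟨ cong (q * φ J +_) (apply-without φ I x) ⟩
  q * φ J + (coeff x I * φ I + apply φ (without I x)) ≡⟨ solve 5 (λ q f g c r → q :* f :+ (c :* g :+ r) := (q :* con 0ℚ :+ c) :* g :+ (q :* f :+ r)) refl q (φ J) (φ I) (coeff x I) _ ⟩
  (q * 0ℚ + coeff x I) * φ I + (q * φ J + apply φ (without I x)) ≡⟨ cong (λ d → (q * d + coeff x I) * φ I + (q * φ J + apply φ (without I x))) (δ-≢ J I (I≢J ∘ sym)) ⟨
  (q * δ (J =ᶜ I) + coeff x I) * φ I + (q * φ J + apply φ (without I x)) ∎

without-≈[] : ∀ I (x : Lin ℓ) → x ≈ [] → without I x ≈ []
without-≈[] I x x≈0 K with I ≟ᶜ K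
... | yes refl = coeff-filter-no (I ≢?_) (λ I≢I → I≢I refl) x
... | no I≢K = trans (coeff-filter-yes (I ≢?_) I≢K x) (x≈0 K)

without-head : ∀ q I (x : Lin ℓ) → without I ((q , I) ∷ x) ≡ without I x
without-head q I x with I ≟ᶜ I
... | yes _ = refl
... | no I≢I = ⊥-elim (I≢I refl)

-- Entries can cancel without the list being empty. All entries indexed by the head's composition
-- are removed together, at the price of their total coefficient, which is zero. The remaining list
-- is not a subterm, hence the length bound `m`.
apply-≈[] : (φ : Functional ℓ) → ∀ m x → length x ≤ m → x ≈ [] → apply φ x ≡ 0ℚ
apply-≈[] φ m [] _ _ = refl
apply-≈[] φ (suc m) x@((q , I) ∷ x′) (s≤s len≤m) x≈0 = begin
  apply φ x ≡⟨ apply-without φ I x ⟩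
  coeff x I * φ I + apply φ (without I x) ≡⟨ cong₂ (λ c y → c * φ I + apply φ y) (x≈0 I) (without-head q I x′) ⟩
  0ℚ * φ I + apply φ (without I x′) ≡⟨ trans (cong (_+ apply φ (without I x′)) (*-zeroˡ (φ I))) (+-identityˡ _) ⟩
  apply φ (without I x′) ≡⟨ apply-≈[] φ m (without I x′) (ℕ.≤-trans (length-filter _ x′) len≤m) (subst (_≈ []) (without-head q I x′) (without-≈[] I x x≈0)) ⟩
  0ℚ ∎

a-b≡0⇒a≡b : ∀ a b → a + (- 1ℚ) * b ≡ 0ℚ → a ≡ b
a-b≡0⇒a≡b a b eq = begin
  a ≡⟨ solve 2 (λ a b → a := (a :+ (:- con 1ℚ) :* b) :+ b) refl a b ⟩
  (a + (- 1ℚ) * b) + b ≡⟨ cong (_+ b) eq ⟩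
  0ℚ + b ≡⟨ +-identityˡ b ⟩
  b ∎

apply-difference : (φ : Functional ℓ) → ∀ x y → apply φ (x ⊕ ((- 1ℚ) ·ₛ y)) ≡ apply φ x + (- 1ℚ) * apply φ y
apply-difference φ x y = trans (apply-++ φ x _) (cong (apply φ x +_) (apply-·ₛ φ (- 1ℚ) y))

apply-≈ : (φ : Functional ℓ) → ∀ {x y} → x ≈ y → apply φ x ≡ apply φ y
apply-≈ φ {x} {y} x≈y = a-b≡0⇒a≡b _ _ (trans (sym (apply-difference φ x y)) (apply-≈[] φ _ (x ⊕ ((- 1ℚ) ·ₛ y)) ℕ.≤-refl difference≈0))
  where
  difference≈0 : (x ⊕ ((- 1ℚ) ·ₛ y)) ≈ []
  difference≈0 K = begin
    coeff (x ⊕ ((- 1ℚ) ·ₛ y)) K ≡⟨ apply-difference _ x y ⟩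
    coeff x K + (- 1ℚ) * coeff y K ≡⟨ cong (_+ (- 1ℚ) * coeff y K) (x≈y K) ⟩
    coeff y K + (- 1ℚ) * coeff y K ≡⟨ solve 1 (λ a → a :+ (:- con 1ℚ) :* a := con 0ℚ) refl (coeff y K) ⟩
    0ℚ ∎

-- Convolution

-- Either the cut precedes `a`, or `a` belongs to the left piece and is absorbed into the functional
-- as `φ ∘ (a ∷_)`. Inductions on compositions therefore let the left functional vary.
⋆-cons : (φ ψ : Functional ℓ) → ∀ a I → (φ ⋆ ψ) (a ∷ I) ≡ φ [] * ψ (a ∷ I) + ((φ ∘ (a ∷_)) ⋆ ψ) I
⋆-cons φ ψ a I = cong (φ [] * ψ (a ∷ I) +_) (∑-map _ _ (splits I))

⋆-cong : {φ φ′ ψ ψ′ : Functional ℓ} → φ ≗ φ′ → ψ ≗ ψ′ → (φ ⋆ ψ) ≗ (φ′ ⋆ ψ′)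
⋆-cong φ≗ ψ≗ I = ∑-cong (λ (J , K) → cong₂ _*_ (φ≗ J) (ψ≗ K)) (splits I)

⋆-zeroˡ : (ψ : Functional ℓ) → ((λ _ → 0ℚ) ⋆ ψ) ≗ (λ _ → 0ℚ)
⋆-zeroˡ ψ I = trans (∑-cong (λ (_ , K) → *-zeroˡ (ψ K)) (splits I)) (∑-zero (splits I))

⋆-zeroʳ : (φ : Functional ℓ) → (φ ⋆ (λ _ → 0ℚ)) ≗ (λ _ → 0ℚ)
⋆-zeroʳ φ I = trans (∑-cong (λ (J , _) → *-zeroʳ (φ J)) (splits I)) (∑-zero (splits I))

⋆-distribʳ-+ : (χ φ ψ : Functional ℓ) → ((λ I → φ I + ψ I) ⋆ χ) ≗ (λ I → (φ ⋆ χ) I + (ψ ⋆ χ) I)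
⋆-distribʳ-+ χ φ ψ I = trans (∑-cong (λ (J , K) → *-distribʳ-+ (χ K) (φ J) (ψ J)) (splits I)) (∑-+ _ _ (splits I))

⋆-distribˡ-+ : (χ φ ψ : Functional ℓ) → (χ ⋆ (λ I → φ I + ψ I)) ≗ (λ I → (χ ⋆ φ) I + (χ ⋆ ψ) I)
⋆-distribˡ-+ χ φ ψ I = trans (∑-cong (λ (J , K) → *-distribˡ-+ (χ J) (φ K) (ψ K)) (splits I)) (∑-+ _ _ (splits I))

⋆-*ˡ : ∀ c (φ ψ : Functional ℓ) → ((λ I → c * φ I) ⋆ ψ) ≗ (λ I → c * (φ ⋆ ψ) I)
⋆-*ˡ c φ ψ I = trans (∑-cong (λ (J , K) → *-assoc c (φ J) (ψ K)) (splits I)) (∑-*ˡ c _ (splits I))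

⋆-*ʳ : ∀ c (φ ψ : Functional ℓ) → (φ ⋆ (λ I → c * ψ I)) ≗ (λ I → c * (φ ⋆ ψ) I)
⋆-*ʳ c φ ψ I = trans (∑-cong (λ (J , K) → *-left-comm (φ J) c (ψ K)) (splits I)) (∑-*ˡ c _ (splits I))

⋆-assoc : (φ ψ χ : Functional ℓ) → ((φ ⋆ ψ) ⋆ χ) ≗ (φ ⋆ (ψ ⋆ χ))
⋆-assoc φ ψ χ [] = solve 3 (λ a b c → (a :* b :+ con 0ℚ) :* c :+ con 0ℚ := a :* (b :* c :+ con 0ℚ) :+ con 0ℚ) refl (φ []) (ψ []) (χ [])
⋆-assoc φ ψ χ (a ∷ I) = begin
  ((φ ⋆ ψ) ⋆ χ) (a ∷ I)
    ≡⟨ ⋆-cons (φ ⋆ ψ) χ a I ⟩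
  (φ [] * ψ [] + 0ℚ) * χ (a ∷ I) + (((φ ⋆ ψ) ∘ (a ∷_)) ⋆ χ) I
    ≡⟨ cong ((φ [] * ψ [] + 0ℚ) * χ (a ∷ I) +_) (trans (⋆-cong (⋆-cons φ ψ a) (λ _ → refl) I) (⋆-distribʳ-+ χ (λ J → φ [] * ψ (a ∷ J)) ((φ ∘ (a ∷_)) ⋆ ψ) I)) ⟩
  (φ [] * ψ [] + 0ℚ) * χ (a ∷ I) + (((λ J → φ [] * ψ (a ∷ J)) ⋆ χ) I + (((φ ∘ (a ∷_)) ⋆ ψ) ⋆ χ) I)
    ≡⟨ cong ((φ [] * ψ [] + 0ℚ) * χ (a ∷ I) +_) (cong₂ _+_ (⋆-*ˡ (φ []) (ψ ∘ (a ∷_)) χ I) (⋆-assoc (φ ∘ (a ∷_)) ψ χ I)) ⟩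
  (φ [] * ψ [] + 0ℚ) * χ (a ∷ I) + (φ [] * ((ψ ∘ (a ∷_)) ⋆ χ) I + ((φ ∘ (a ∷_)) ⋆ (ψ ⋆ χ)) I)
    ≡⟨ solve 5 (λ a b c d e → (a :* b :+ con 0ℚ) :* c :+ (a :* d :+ e) := a :* (b :* c :+ d) :+ e) refl (φ []) (ψ []) (χ (a ∷ I)) _ _ ⟩
  φ [] * (ψ [] * χ (a ∷ I) + ((ψ ∘ (a ∷_)) ⋆ χ) I) + ((φ ∘ (a ∷_)) ⋆ (ψ ⋆ χ)) I
    ≡⟨ cong (λ t → φ [] * t + ((φ ∘ (a ∷_)) ⋆ (ψ ⋆ χ)) I) (⋆-cons ψ χ a I) ⟨
  φ [] * (ψ ⋆ χ) (a ∷ I) + ((φ ∘ (a ∷_)) ⋆ (ψ ⋆ χ)) I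
    ≡⟨ ⋆-cons φ (ψ ⋆ χ) a I ⟨
  (φ ⋆ (ψ ⋆ χ)) (a ∷ I) ∎

δ⟨_⟩ : Comp ℓ → Functional ℓ
δ⟨ P ⟩ I = δ (P =ᶜ I)

δ-⋆ : (P Q : Comp ℓ) → (δ⟨ P ⟩ ⋆ δ⟨ Q ⟩) ≗ δ⟨ P ++ Q ⟩
δ-⋆ [] Q [] = trans (+-identityʳ _) (*-identityˡ (δ (Q =ᶜ [])))
δ-⋆ [] Q (a ∷ K) = begin
  (δ⟨ [] ⟩ ⋆ δ⟨ Q ⟩) (a ∷ K) ≡⟨ ⋆-cons δ⟨ [] ⟩ δ⟨ Q ⟩ a K ⟩
  1ℚ * δ⟨ Q ⟩ (a ∷ K) + ((λ _ → 0ℚ) ⋆ δ⟨ Q ⟩) K ≡⟨ cong₂ _+_ (*-identityˡ (δ⟨ Q ⟩ (a ∷ K))) (⋆-zeroˡ δ⟨ Q ⟩ K) ⟩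
  δ⟨ Q ⟩ (a ∷ K) + 0ℚ ≡⟨ +-identityʳ _ ⟩
  δ⟨ Q ⟩ (a ∷ K) ∎
δ-⋆ (b ∷ P) Q [] = trans (+-identityʳ _) (*-zeroˡ (δ (Q =ᶜ [])))
δ-⋆ (b ∷ P) Q (a ∷ K) = begin
  (δ⟨ b ∷ P ⟩ ⋆ δ⟨ Q ⟩) (a ∷ K) ≡⟨ ⋆-cons δ⟨ b ∷ P ⟩ δ⟨ Q ⟩ a K ⟩
  0ℚ * δ⟨ Q ⟩ (a ∷ K) + tail ≡⟨ trans (cong (_+ tail) (*-zeroˡ (δ⟨ Q ⟩ (a ∷ K)))) (+-identityˡ tail) ⟩
  tail ≡⟨ tail-≡ ⟩
  δ⟨ b ∷ P ++ Q ⟩ (a ∷ K) ∎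
  where
  tail : ℚ
  tail = ((δ⟨ b ∷ P ⟩ ∘ (a ∷_)) ⋆ δ⟨ Q ⟩) K
  tail-≡ : tail ≡ δ⟨ b ∷ P ++ Q ⟩ (a ∷ K)
  tail-≡ with proj₁ b =ᵥ proj₁ a
  ... | true = δ-⋆ P Q K
  ... | false = ⋆-zeroˡ δ⟨ Q ⟩ K

-- Concatenation is dual to deconcatenation; through this identity every product in `NSym` is
-- handled as a convolution of coefficient functionals.
coeff-· : (x y : NSym ℓ) → coeff (x · y) ≗ (coeff x ⋆ coeff y)
coeff-· [] y I = sym (⋆-zeroˡ (coeff y) I)
coeff-· ((p , P) ∷ x) y I = begin
  coeff (map _ y ++ (x · y)) I ≡⟨ apply-++ _ (map _ y) (x · y) ⟩
  coeff (map _ y) I + coeff (x · y) I ≡⟨ cong₂ _+_ (monomial y) (coeff-· x y I) ⟩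
  (pδ ⋆ coeff y) I + (coeff x ⋆ coeff y) I ≡⟨ ⋆-distribʳ-+ (coeff y) pδ (coeff x) I ⟨
  (coeff ((p , P) ∷ x) ⋆ coeff y) I ∎
  where
  pδ : Functional _
  pδ J = p * δ⟨ P ⟩ J
  monomial : ∀ y → coeff (map (λ qJ → (p * proj₁ qJ , P ++ proj₂ qJ)) y) I ≡ (pδ ⋆ coeff y) I
  monomial [] = sym (⋆-zeroʳ pδ I)
  monomial ((q , Q) ∷ y) = begin
    p * q * δ⟨ P ++ Q ⟩ I + coeff (map _ y) I
      ≡⟨ cong₂ _+_ (cong (p * q *_) (sym (δ-⋆ P Q I))) (monomial y) ⟩
    p * q * (δ⟨ P ⟩ ⋆ δ⟨ Q ⟩) I + (pδ ⋆ coeff y) I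
      ≡⟨ cong (_+ (pδ ⋆ coeff y) I) (solve 3 (λ p q d → p :* q :* d := q :* (p :* d)) refl p q _) ⟩
    q * (p * (δ⟨ P ⟩ ⋆ δ⟨ Q ⟩) I) + (pδ ⋆ coeff y) I
      ≡⟨ cong (λ t → q * t + (pδ ⋆ coeff y) I) (⋆-*ˡ p δ⟨ P ⟩ δ⟨ Q ⟩ I) ⟨
    q * (pδ ⋆ δ⟨ Q ⟩) I + (pδ ⋆ coeff y) I
      ≡⟨ cong (_+ (pδ ⋆ coeff y) I) (⋆-*ʳ q pδ δ⟨ Q ⟩ I) ⟨
    (pδ ⋆ (λ J → q * δ⟨ Q ⟩ J)) I + (pδ ⋆ coeff y) I
      ≡⟨ ⋆-distribˡ-+ pδ (λ J → q * δ⟨ Q ⟩ J) (coeff y) I ⟨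
    (pδ ⋆ coeff ((q , Q) ∷ y)) I ∎

-- Degrees and the merging of columns

∣0ᵥ∣ : ∀ ℓ → ∣ 0ᵥ {ℓ} ∣ᵥ ≡ 0
∣0ᵥ∣ zero = refl
∣0ᵥ∣ (suc ℓ) = ∣0ᵥ∣ ℓ

∣+ᵥ∣ : (v w : Vec ℕ ℓ) → ∣ v +ᵥ w ∣ᵥ ≡ ∣ v ∣ᵥ ℕ.+ ∣ w ∣ᵥ
∣+ᵥ∣ [] [] = refl
∣+ᵥ∣ (x ∷ v) (y ∷ w) = begin
  (x ℕ.+ y) ℕ.+ ∣ v +ᵥ w ∣ᵥ ≡⟨ cong ((x ℕ.+ y) ℕ.+_) (∣+ᵥ∣ v w) ⟩
  (x ℕ.+ y) ℕ.+ (∣ v ∣ᵥ ℕ.+ ∣ w ∣ᵥ) ≡⟨ interchange x y ∣ v ∣ᵥ ∣ w ∣ᵥ ⟩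
  (x ℕ.+ ∣ v ∣ᵥ) ℕ.+ (y ℕ.+ ∣ w ∣ᵥ) ∎
  where open import Algebra.Properties.CommutativeSemigroup ℕ.+-commutativeSemigroup using (interchange)

+ᵥ-assoc : (u v w : Vec ℕ ℓ) → (u +ᵥ v) +ᵥ w ≡ u +ᵥ (v +ᵥ w)
+ᵥ-assoc = Vec.zipWith-assoc ℕ.+-assoc

+ᵥ-identityˡ : (v : Vec ℕ ℓ) → 0ᵥ +ᵥ v ≡ v
+ᵥ-identityˡ = Vec.zipWith-identityˡ ℕ.+-identityˡ

+ᵥ-identityʳ : (v : Vec ℕ ℓ) → v +ᵥ 0ᵥ ≡ v
+ᵥ-identityʳ = Vec.zipWith-identityʳ ℕ.+-identityʳ

nz⇒pos : (v : Vec ℕ ℓ) → T (nz? v) → 0 < ∣ v ∣ᵥ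
nz⇒pos (zero ∷ v) nz = nz⇒pos v nz
nz⇒pos (suc x ∷ v) nz = s≤s z≤n

pos⇒nz : (v : Vec ℕ ℓ) → 0 < ∣ v ∣ᵥ → T (nz? v)
pos⇒nz (zero ∷ v) pos = pos⇒nz v pos
pos⇒nz (suc x ∷ v) pos = tt

∣NZ∣>0 : (a : NZ ℓ) → 0 < ∣ proj₁ a ∣ᵥ
∣NZ∣>0 (v , nz) = nz⇒pos v nz

infixl 6 _⊹_
_⊹_ : NZ ℓ → NZ ℓ → NZ ℓ
a ⊹ b = proj₁ a +ᵥ proj₁ b , pos⇒nz (proj₁ a +ᵥ proj₁ b) (subst (0 <_) (sym (∣+ᵥ∣ (proj₁ a) (proj₁ b))) (ℕ.<-≤-trans (∣NZ∣>0 a) (ℕ.m≤m+n _ _)))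

⊹-assoc : (a b c : NZ ℓ) → (a ⊹ b) ⊹ c ≡ a ⊹ (b ⊹ c)
⊹-assoc a b c = NZ-≡ (+ᵥ-assoc (proj₁ a) (proj₁ b) (proj₁ c))

deg-⊹ : (a b : NZ ℓ) → ∀ I → deg (a ⊹ b ∷ I) ≡ deg (a ∷ b ∷ I)
deg-⊹ a b I = +ᵥ-assoc (proj₁ a) (proj₁ b) (deg I)

-- Weighted coarsening

-- W p q φ I = Σ_{J ⊴ I} p^(len J) q^(len I − len J) φ(J), and W₁ p q φ a I = W p q φ (a ∷ I).
-- Hence W 2 1 φ I = φ(η_I).
W₁ : ℚ → ℚ → Functional ℓ → NZ ℓ → Functional ℓ
W₁ p q φ a [] = p * φ (a ∷ [])
W₁ p q φ a (b ∷ I) = p * W₁ p q (φ ∘ (a ∷_)) b I + q * W₁ p q φ (a ⊹ b) I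

W : ℚ → ℚ → Functional ℓ → Functional ℓ
W p q φ [] = φ []
W p q φ (a ∷ I) = W₁ p q φ a I

-- Coarsening preserves the degree and never empties a nonempty composition, so only such values of
-- the functional are consulted. The degree condition gives `W-∣`; nonemptiness allows rewriting
-- with identities that fail at `[]`.
W₁-local : ∀ p q {φ ψ : Functional ℓ} a I → (∀ b J → deg (b ∷ J) ≡ deg (a ∷ I) → φ (b ∷ J) ≡ ψ (b ∷ J)) → W₁ p q φ a I ≡ W₁ p q ψ a I
W₁-local p q a [] φ≡ψ = cong (p *_) (φ≡ψ a [] refl)
W₁-local p q a (b ∷ I) φ≡ψ = cong₂ (λ s t → p * s + q * t)
  (W₁-local p q b I λ c J eq → φ≡ψ a (c ∷ J) (cong (proj₁ a +ᵥ_) eq))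
  (W₁-local p q (a ⊹ b) I λ c J eq → φ≡ψ c J (trans eq (deg-⊹ a b I)))

W-local : ∀ p q {φ ψ : Functional ℓ} I → (∀ J → deg J ≡ deg I → φ J ≡ ψ J) → W p q φ I ≡ W p q ψ I
W-local p q [] φ≡ψ = φ≡ψ [] refl
W-local p q (a ∷ I) φ≡ψ = W₁-local p q a I λ b J → φ≡ψ (b ∷ J)

W-cong : ∀ p q {φ ψ : Functional ℓ} → φ ≗ ψ → W p q φ ≗ W p q ψ
W-cong p q φ≗ψ I = W-local p q I λ J _ → φ≗ψ J

W₁-linear : ∀ p q c d (φ ψ : Functional ℓ) a I → W₁ p q (λ J → c * φ J + d * ψ J) a I ≡ c * W₁ p q φ a I + d * W₁ p q ψ a I
W₁-linear p q c d φ ψ a [] = solve 5 (λ p c d s t → p :* (c :* s :+ d :* t) := c :* (p :* s) :+ d :* (p :* t)) refl p c d (φ (a ∷ [])) (ψ (a ∷ []))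
W₁-linear p q c d φ ψ a (b ∷ I) = begin
  W₁ p q (λ J → c * φ J + d * ψ J) a (b ∷ I)
    ≡⟨ cong₂ (λ s t → p * s + q * t) (W₁-linear p q c d (φ ∘ (a ∷_)) (ψ ∘ (a ∷_)) b I) (W₁-linear p q c d φ ψ (a ⊹ b) I) ⟩
  p * (c * W₁ p q (φ ∘ (a ∷_)) b I + d * W₁ p q (ψ ∘ (a ∷_)) b I) + q * (c * W₁ p q φ (a ⊹ b) I + d * W₁ p q ψ (a ⊹ b) I)
    ≡⟨ solve 8 (λ p q c d s t s′ t′ → p :* (c :* s :+ d :* t) :+ q :* (c :* s′ :+ d :* t′) := c :* (p :* s :+ q :* s′) :+ d :* (p :* t :+ q :* t′)) refl p q c d
         (W₁ p q (φ ∘ (a ∷_)) b I) (W₁ p q (ψ ∘ (a ∷_)) b I) (W₁ p q φ (a ⊹ b) I) (W₁ p q ψ (a ⊹ b) I) ⟩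
  c * W₁ p q φ a (b ∷ I) + d * W₁ p q ψ a (b ∷ I) ∎

W-linear : ∀ p q c d (φ ψ : Functional ℓ) I → W p q (λ J → c * φ J + d * ψ J) I ≡ c * W p q φ I + d * W p q ψ I
W-linear p q c d φ ψ [] = refl
W-linear p q c d φ ψ (a ∷ I) = W₁-linear p q c d φ ψ a I

W₁-zero : ∀ p q {φ : Functional ℓ} → (∀ b J → φ (b ∷ J) ≡ 0ℚ) → ∀ a I → W₁ p q φ a I ≡ 0ℚ
W₁-zero p q φ≡0 a [] = trans (cong (p *_) (φ≡0 a [])) (*-zeroʳ p)
W₁-zero p q φ≡0 a (b ∷ I) = begin
  W₁ p q _ a (b ∷ I) ≡⟨ cong₂ (λ s t → p * s + q * t) (W₁-zero p q (λ c J → φ≡0 a (c ∷ J)) b I) (W₁-zero p q φ≡0 (a ⊹ b) I) ⟩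
  p * 0ℚ + q * 0ℚ ≡⟨ cong₂ _+_ (*-zeroʳ p) (*-zeroʳ q) ⟩
  0ℚ ∎

W-zero : ∀ p q I → W {ℓ} p q (λ _ → 0ℚ) I ≡ 0ℚ
W-zero p q [] = refl
W-zero p q (a ∷ I) = W₁-zero p q (λ _ _ → refl) a I

W-apply : ∀ p q (f : Comp ℓ → Functional ℓ) x I → W p q (λ K → apply (λ J → f J K) x) I ≡ apply (λ J → W p q (f J) I) x
W-apply p q f [] I = W-zero p q I
W-apply p q f ((c , J) ∷ x) I = begin
  W p q (λ K → c * f J K + rest K) I ≡⟨ W-cong p q (λ K → cong (c * f J K +_) (sym (*-identityˡ (rest K)))) I ⟩
  W p q (λ K → c * f J K + 1ℚ * rest K) I ≡⟨ W-linear p q c 1ℚ (f J) rest I ⟩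
  c * W p q (f J) I + 1ℚ * W p q rest I ≡⟨ cong (c * W p q (f J) I +_) (trans (*-identityˡ _) (W-apply p q f x I)) ⟩
  c * W p q (f J) I + apply (λ J → W p q (f J) I) x ∎
  where
  rest : Functional _
  rest K = apply (λ J → f J K) x

-- Glues `a` onto the first column before evaluating. At `[]` there is no column to glue to, hence
-- the default 0.
shift : NZ ℓ → Functional ℓ → Functional ℓ
shift a φ [] = 0ℚ
shift a φ (b ∷ J) = φ (a ⊹ b ∷ J)

W₁-shift : ∀ p q (φ : Functional ℓ) a b I → W₁ p q (shift a φ) b I ≡ W₁ p q φ (a ⊹ b) I
W₁-shift p q φ a b [] = refl
W₁-shift p q φ a b (c ∷ I) = cong (λ t → p * W₁ p q (φ ∘ (a ⊹ b ∷_)) c I + q * t)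
  (trans (W₁-shift p q φ a (b ⊹ c) I) (cong (λ d → W₁ p q φ d I) (sym (⊹-assoc a b c))))

-- A gap survives both rounds with weight `p * p′`. It is closed either at once, with weight `q`, or
-- kept in the outer round and closed in the inner one, with weight `p * q′`.
W₁-∘ : ∀ p q p′ q′ (φ : Functional ℓ) a I → W₁ p q (W p′ q′ φ) a I ≡ W₁ (p * p′) (p * q′ + q) φ a I
W₁-∘ p q p′ q′ φ a [] = sym (*-assoc p p′ _)
W₁-∘ p q p′ q′ φ a (b ∷ I) = begin
  p * W₁ p q (W₁ p′ q′ φ a) b I + q * W₁ p q (W p′ q′ φ) (a ⊹ b) I
    ≡⟨ cong (λ t → p * t + q * W₁ p q (W p′ q′ φ) (a ⊹ b) I) (begin
         W₁ p q (W₁ p′ q′ φ a) b I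
           -- On nonempty `J` this is the defining recursion of `W₁ p′ q′ φ a`, split by the fate of
           -- the gap after `a`.
           ≡⟨ W₁-local p q b I (λ _ _ _ → refl) ⟩
         W₁ p q (λ J → p′ * W p′ q′ (φ ∘ (a ∷_)) J + q′ * shift a (W p′ q′ φ) J) b I
           ≡⟨ W₁-linear p q p′ q′ (W p′ q′ (φ ∘ (a ∷_))) (shift a (W p′ q′ φ)) b I ⟩
         p′ * W₁ p q (W p′ q′ (φ ∘ (a ∷_))) b I + q′ * W₁ p q (shift a (W p′ q′ φ)) b I
           ≡⟨ cong (λ t → p′ * W₁ p q (W p′ q′ (φ ∘ (a ∷_))) b I + q′ * t) (W₁-shift p q (W p′ q′ φ) a b I) ⟩
         p′ * W₁ p q (W p′ q′ (φ ∘ (a ∷_))) b I + q′ * W₁ p q (W p′ q′ φ) (a ⊹ b) I ∎) ⟩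
  p * (p′ * W₁ p q (W p′ q′ (φ ∘ (a ∷_))) b I + q′ * W₁ p q (W p′ q′ φ) (a ⊹ b) I) + q * W₁ p q (W p′ q′ φ) (a ⊹ b) I
    ≡⟨ solve 6 (λ p q p′ q′ s t → p :* (p′ :* s :+ q′ :* t) :+ q :* t := p :* p′ :* s :+ (p :* q′ :+ q) :* t) refl p q p′ q′ (W₁ p q (W p′ q′ (φ ∘ (a ∷_))) b I) (W₁ p q (W p′ q′ φ) (a ⊹ b) I) ⟩
  p * p′ * W₁ p q (W p′ q′ (φ ∘ (a ∷_))) b I + (p * q′ + q) * W₁ p q (W p′ q′ φ) (a ⊹ b) I
    ≡⟨ cong₂ (λ s t → p * p′ * s + (p * q′ + q) * t) (W₁-∘ p q p′ q′ (φ ∘ (a ∷_)) b I) (W₁-∘ p q p′ q′ φ (a ⊹ b) I) ⟩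
  W₁ (p * p′) (p * q′ + q) φ a (b ∷ I) ∎

W₁-1-0 : (φ : Functional ℓ) → ∀ a I → W₁ 1ℚ 0ℚ φ a I ≡ φ (a ∷ I)
W₁-1-0 φ a [] = *-identityˡ _
W₁-1-0 φ a (b ∷ I) = begin
  1ℚ * W₁ 1ℚ 0ℚ (φ ∘ (a ∷_)) b I + 0ℚ * W₁ 1ℚ 0ℚ φ (a ⊹ b) I ≡⟨ cong₂ _+_ (*-identityˡ (W₁ 1ℚ 0ℚ (φ ∘ (a ∷_)) b I)) (*-zeroˡ (W₁ 1ℚ 0ℚ φ (a ⊹ b) I)) ⟩
  W₁ 1ℚ 0ℚ (φ ∘ (a ∷_)) b I + 0ℚ ≡⟨ +-identityʳ _ ⟩
  W₁ 1ℚ 0ℚ (φ ∘ (a ∷_)) b I ≡⟨ W₁-1-0 (φ ∘ (a ∷_)) b I ⟩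
  φ (a ∷ b ∷ I) ∎

-- A cut of a coarsening of `I` is a cut of `I` together with a coarsening of each side, and lengths
-- add, so the weights multiply. The separate first summand is the cut before `a`.
W₁-⋆ : ∀ p q (φ ψ : Functional ℓ) a I → W₁ p q (φ ⋆ ψ) a I ≡ φ [] * W₁ p q ψ a I + (W₁ p q φ a ⋆ W p q ψ) I
W₁-⋆ p q φ ψ a [] = begin
  p * (φ ⋆ ψ) (a ∷ []) ≡⟨ cong (p *_) (⋆-cons φ ψ a []) ⟩
  p * (φ [] * ψ (a ∷ []) + (φ (a ∷ []) * ψ [] + 0ℚ))
    ≡⟨ solve 5 (λ p s t u v → p :* (s :* t :+ (u :* v :+ con 0ℚ)) := s :* (p :* t) :+ (p :* u :* v :+ con 0ℚ)) refl p (φ []) (ψ (a ∷ [])) (φ (a ∷ [])) (ψ []) ⟩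
  φ [] * (p * ψ (a ∷ [])) + (p * φ (a ∷ []) * ψ [] + 0ℚ) ∎
W₁-⋆ p q φ ψ a (b ∷ I) = begin
  p * W₁ p q ((φ ⋆ ψ) ∘ (a ∷_)) b I + q * W₁ p q (φ ⋆ ψ) (a ⊹ b) I
    ≡⟨ cong₂ (λ s t → p * s + q * t) front (W₁-⋆ p q φ ψ (a ⊹ b) I) ⟩
  p * (f * X + (g * Y + C)) + q * (f * Z + D)
    ≡⟨ solve 9 (λ p q f g X Y Z C D → p :* (f :* X :+ (g :* Y :+ C)) :+ q :* (f :* Z :+ D) := f :* (p :* X :+ q :* Z) :+ (p :* g :* Y :+ (p :* C :+ q :* D))) refl p q f g X Y Z C D ⟩
  f * (p * X + q * Z) + (p * g * Y + (p * C + q * D))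
    ≡⟨ cong (λ t → f * (p * X + q * Z) + (p * g * Y + t)) back ⟨
  f * (p * X + q * Z) + (p * g * Y + ((λ J → p * W₁ p q φa b J + q * W₁ p q φ (a ⊹ b) J) ⋆ W p q ψ) I)
    ≡⟨ cong (f * (p * X + q * Z) +_) (⋆-cons (W₁ p q φ a) (W p q ψ) b I) ⟨
  φ [] * W₁ p q ψ a (b ∷ I) + (W₁ p q φ a ⋆ W p q ψ) (b ∷ I) ∎
  where
  φa : Functional _
  φa J = φ (a ∷ J)
  f g X Y Z C D : ℚ
  f = φ []
  g = φ (a ∷ [])
  X = W₁ p q (ψ ∘ (a ∷_)) b I
  Y = W₁ p q ψ b I
  Z = W₁ p q ψ (a ⊹ b) I
  C = (W₁ p q φa b ⋆ W p q ψ) I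
  D = (W₁ p q φ (a ⊹ b) ⋆ W p q ψ) I
  front : W₁ p q ((φ ⋆ ψ) ∘ (a ∷_)) b I ≡ f * X + (g * Y + C)
  front = begin
    W₁ p q ((φ ⋆ ψ) ∘ (a ∷_)) b I
      ≡⟨ W₁-local p q b I (λ c J _ → trans (⋆-cons φ ψ a (c ∷ J)) (cong (φ [] * ψ (a ∷ c ∷ J) +_) (sym (*-identityˡ ((φa ⋆ ψ) (c ∷ J)))))) ⟩
    W₁ p q (λ J → f * ψ (a ∷ J) + 1ℚ * (φa ⋆ ψ) J) b I
      ≡⟨ W₁-linear p q f 1ℚ (ψ ∘ (a ∷_)) (φa ⋆ ψ) b I ⟩
    f * X + 1ℚ * W₁ p q (φa ⋆ ψ) b I
      ≡⟨ cong (f * X +_) (trans (*-identityˡ _) (W₁-⋆ p q φa ψ b I)) ⟩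
    f * X + (g * Y + C) ∎
  back : ((λ J → p * W₁ p q φa b J + q * W₁ p q φ (a ⊹ b) J) ⋆ W p q ψ) I ≡ p * C + q * D
  back = trans (⋆-distribʳ-+ (W p q ψ) (λ J → p * W₁ p q φa b J) (λ J → q * W₁ p q φ (a ⊹ b) J) I)
    (cong₂ _+_ (⋆-*ˡ p (W₁ p q φa b) (W p q ψ) I) (⋆-*ˡ q (W₁ p q φ (a ⊹ b)) (W p q ψ) I))

W-⋆ : ∀ p q (φ ψ : Functional ℓ) → W p q (φ ⋆ ψ) ≗ (W p q φ ⋆ W p q ψ)
W-⋆ p q φ ψ [] = refl
W-⋆ p q φ ψ (a ∷ I) = trans (W₁-⋆ p q φ ψ a I) (sym (⋆-cons (W p q φ) (W p q ψ) a I))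

-- The combination on which every functional `φ` takes the value `W₁ p q φ a I`. For weights 2 and 1
-- it is η itself; for `½` and `- ½` its entries are the coordinates of M in the η basis.
WLin₁ : ℚ → ℚ → NZ ℓ → Comp ℓ → Lin ℓ
WLin₁ p q a [] = (p , a ∷ []) ∷ []
WLin₁ p q a (b ∷ I) = map (λ (c , J) → (p * c , a ∷ J)) (WLin₁ p q b I) ++ (q ·ₛ WLin₁ p q (a ⊹ b) I)

WLin : ℚ → ℚ → Comp ℓ → Lin ℓ
WLin p q [] = e []
WLin p q (a ∷ I) = WLin₁ p q a I

apply-WLin₁ : ∀ p q (φ : Functional ℓ) a I → apply φ (WLin₁ p q a I) ≡ W₁ p q φ a I
apply-WLin₁ p q φ a [] = +-identityʳ _
apply-WLin₁ p q φ a (b ∷ I) = begin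
  apply φ (WLin₁ p q a (b ∷ I))
    ≡⟨ apply-++ φ (map (λ (c , J) → (p * c , a ∷ J)) (WLin₁ p q b I)) _ ⟩
  apply φ (map (λ (c , J) → (p * c , a ∷ J)) (WLin₁ p q b I)) + apply φ (q ·ₛ WLin₁ p q (a ⊹ b) I)
    ≡⟨ cong₂ _+_ prepend (trans (apply-·ₛ φ q (WLin₁ p q (a ⊹ b) I)) (cong (q *_) (apply-WLin₁ p q φ (a ⊹ b) I))) ⟩
  W₁ p q φ a (b ∷ I) ∎
  where
  prepend : apply φ (map (λ (c , J) → (p * c , a ∷ J)) (WLin₁ p q b I)) ≡ p * W₁ p q (φ ∘ (a ∷_)) b I
  prepend = begin
    apply φ (map (λ (c , J) → (p * c , a ∷ J)) (WLin₁ p q b I)) ≡⟨ ∑-map _ _ (WLin₁ p q b I) ⟩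
    ∑ (λ (c , J) → p * c * φ (a ∷ J)) (WLin₁ p q b I) ≡⟨ ∑-cong (λ (c , J) → *-assoc p c (φ (a ∷ J))) (WLin₁ p q b I) ⟩
    ∑ (λ (c , J) → p * (c * φ (a ∷ J))) (WLin₁ p q b I) ≡⟨ ∑-*ˡ p _ (WLin₁ p q b I) ⟩
    p * apply (φ ∘ (a ∷_)) (WLin₁ p q b I) ≡⟨ cong (p *_) (apply-WLin₁ p q (φ ∘ (a ∷_)) b I) ⟩
    p * W₁ p q (φ ∘ (a ∷_)) b I ∎

apply-WLin : ∀ p q (φ : Functional ℓ) I → apply φ (WLin p q I) ≡ W p q φ I
apply-WLin p q φ [] = trans (+-identityʳ _) (*-identityˡ _)
apply-WLin p q φ (a ∷ I) = apply-WLin₁ p q φ a I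

2ℚ : ℚ
2ℚ = 1ℚ + 1ℚ

-- The weights of `Sη` solve `p * 2 = 1` and `p * 1 + q = 0`, which by `W₁-∘` makes the two
-- operators mutually inverse.
Tη Sη : Functional ℓ → Functional ℓ
Tη = W 2ℚ 1ℚ
Sη = W ½ (- ½)

Sη-Tη : (φ : Functional ℓ) → Sη (Tη φ) ≗ φ
Sη-Tη φ [] = refl
Sη-Tη φ (a ∷ I) = trans (W₁-∘ ½ (- ½) 2ℚ 1ℚ φ a I) (W₁-1-0 φ a I)

Tη-Sη : (φ : Functional ℓ) → Tη (Sη φ) ≗ φ
Tη-Sη φ [] = refl
Tη-Sη φ (a ∷ I) = trans (W₁-∘ 2ℚ 1ℚ ½ (- ½) φ a I) (W₁-1-0 φ a I)

-- The η basis

2^suc : ∀ m → ℕ→ℚ (2 ^ suc m) ≡ 2ℚ * ℕ→ℚ (2 ^ m)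
2^suc m = ℚ.toℚᵘ-injective (ℚᵘ.≃-trans (ℚ.toℚᵘ-fromℚᵘ (mkℚᵘ (ℤ.+ (2 ^ suc m)) 0)) (ℚᵘ.≃-sym (ℚᵘ.≃-trans (ℚ.toℚᵘ-homo-* 2ℚ (ℕ→ℚ (2 ^ m)))
  (ℚᵘ.≃-trans (ℚᵘ.*-congˡ {toℚᵘ 2ℚ} (ℚ.toℚᵘ-fromℚᵘ (mkℚᵘ (ℤ.+ (2 ^ m)) 0))) (*≡* (cong (ℤ._* ℤ.1ℤ) (sym (ℤ.pos-* 2 (2 ^ m)))))))))

coarsen-go-[] : (acc : Vec ℕ ℓ) (a : NZ ℓ) → ∀ I → coarsen-go acc [] (a ∷ I) ≡ false
coarsen-go-[] {ℓ} acc a [] = cong (_∨ false) (=ᵥ-complete (acc +ᵥ proj₁ a) 0ᵥ λ eq → ℕ.<⇒≢ pos (sym (trans (cong ∣_∣ᵥ eq) (∣0ᵥ∣ ℓ))))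
  where
  pos : 0 < ∣ acc +ᵥ proj₁ a ∣ᵥ
  pos = subst (0 <_) (sym (∣+ᵥ∣ acc (proj₁ a))) (ℕ.<-≤-trans (∣NZ∣>0 a) (ℕ.m≤n+m _ _))
coarsen-go-[] acc a (b ∷ I) = cong (_∨ false) (coarsen-go-[] (acc +ᵥ proj₁ a) b I)

-- The size of an open block never decreases, so a block that has outgrown `c` cannot be closed on
-- it. Hence at most one side of the `_∨_` in `coarsen-go` is true, and the Boolean test agrees with
-- a sum over coarsenings.
coarsen-go-large : (acc : Vec ℕ ℓ) (c a : NZ ℓ) → ∀ J I → ∣ proj₁ c ∣ᵥ < ∣ acc +ᵥ proj₁ a ∣ᵥ → coarsen-go acc (c ∷ J) (a ∷ I) ≡ false
coarsen-go-large acc c a J I c<acc+a = cong₂ _∨_ (continue I) (cong (_∧ coarsen-go 0ᵥ J I) (=ᵥ-complete (acc +ᵥ proj₁ a) (proj₁ c) λ eq → ℕ.<⇒≢ c<acc+a (sym (cong ∣_∣ᵥ eq))))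
  where
  continue : ∀ I → coarsen-go (acc +ᵥ proj₁ a) (c ∷ J) I ≡ false
  continue [] = refl
  continue (b ∷ I) = coarsen-go-large (acc +ᵥ proj₁ a) c b J I
    (ℕ.<-≤-trans c<acc+a (subst (∣ acc +ᵥ proj₁ a ∣ᵥ ≤_) (sym (∣+ᵥ∣ (acc +ᵥ proj₁ a) (proj₁ b))) (ℕ.m≤m+n _ _)))

δᶜ : Comp ℓ → Functional ℓ
δᶜ J K = δ (K =ᶜ J)

weight : Bool → Comp ℓ → ℚ
weight b J = if b then ℕ→ℚ (2 ^ len J) else 0ℚ

weight-∷ : ∀ b (c : NZ ℓ) J → weight b (c ∷ J) ≡ 2ℚ * weight b J
weight-∷ true c J = 2^suc (len J)
weight-∷ false c J = refl

weight-[] : ∀ b (J : Comp ℓ) → weight (b ∧ coarsen-go 0ᵥ J []) J ≡ δ (b ∧ ([] =ᶜ J))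
weight-[] {ℓ} true [] rewrite =ᵥ-refl (0ᵥ {ℓ}) = refl
weight-[] false [] = refl
weight-[] true (_ ∷ _) = refl
weight-[] false (_ ∷ _) = refl

-- The two recursions are out of step by one column: `W₁` holds the open block including its latest
-- column, while `coarsen-go` holds `acc` and has `a′` still to read. The hypothesis on `a` aligns
-- them.
W₁-δᶜ : (acc : Vec ℕ ℓ) (a a′ : NZ ℓ) → acc +ᵥ proj₁ a′ ≡ proj₁ a → ∀ I J → W₁ 2ℚ 1ℚ (δᶜ J) a I ≡ weight (coarsen-go acc J (a′ ∷ I)) J
W₁-δᶜ {ℓ} acc a a′ eq I [] = trans (W₁-zero 2ℚ 1ℚ (λ _ _ → refl) a I) (cong (λ b → weight {ℓ} b []) (sym (coarsen-go-[] acc a′ I)))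
W₁-δᶜ acc a a′ refl [] (c ∷ J) = sym (trans (weight-∷ ((proj₁ a =ᵥ proj₁ c) ∧ coarsen-go 0ᵥ J []) c J) (cong (2ℚ *_) (weight-[] (proj₁ a =ᵥ proj₁ c) J)))
W₁-δᶜ acc a a′ refl (b ∷ I) (c ∷ J) with proj₁ a =ᵥ proj₁ c in eq
... | false = begin
  2ℚ * W₁ 2ℚ 1ℚ (λ _ → 0ℚ) b I + 1ℚ * X ≡⟨ cong (λ t → 2ℚ * t + 1ℚ * X) (W₁-zero 2ℚ 1ℚ (λ _ _ → refl) b I) ⟩
  2ℚ * 0ℚ + 1ℚ * X ≡⟨ solve 1 (λ x → con 2ℚ :* con 0ℚ :+ con 1ℚ :* x := x) refl X ⟩
  X ≡⟨ W₁-δᶜ (proj₁ a) (a ⊹ b) b refl I (c ∷ J) ⟩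
  weight (coarsen-go (proj₁ a) (c ∷ J) (b ∷ I)) (c ∷ J) ≡⟨ cong (λ t → weight t (c ∷ J)) (∨-identityʳ _) ⟨
  weight (coarsen-go (proj₁ a) (c ∷ J) (b ∷ I) ∨ false) (c ∷ J) ∎
  where
  X : ℚ
  X = W₁ 2ℚ 1ℚ (δᶜ (c ∷ J)) (a ⊹ b) I
... | true = begin
  2ℚ * W₁ 2ℚ 1ℚ (δᶜ J) b I + 1ℚ * W₁ 2ℚ 1ℚ (δᶜ (c ∷ J)) (a ⊹ b) I
    ≡⟨ cong₂ (λ s t → 2ℚ * s + 1ℚ * t) (W₁-δᶜ 0ᵥ b b (+ᵥ-identityˡ _) I J) (trans (W₁-δᶜ (proj₁ a) (a ⊹ b) b refl I (c ∷ J)) (cong (λ t → weight t (c ∷ J)) large)) ⟩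
  2ℚ * weight (coarsen-go 0ᵥ J (b ∷ I)) J + 0ℚ
    ≡⟨ trans (+-identityʳ _) (sym (weight-∷ (coarsen-go 0ᵥ J (b ∷ I)) c J)) ⟩
  weight (coarsen-go 0ᵥ J (b ∷ I)) (c ∷ J)
    ≡⟨ cong (λ t → weight (t ∨ coarsen-go 0ᵥ J (b ∷ I)) (c ∷ J)) large ⟨
  weight (coarsen-go (proj₁ a) (c ∷ J) (b ∷ I) ∨ coarsen-go 0ᵥ J (b ∷ I)) (c ∷ J) ∎
  where
  large : coarsen-go (proj₁ a) (c ∷ J) (b ∷ I) ≡ false
  large = coarsen-go-large (proj₁ a) c b J I (subst (∣ proj₁ c ∣ᵥ <_) (sym (∣+ᵥ∣ (proj₁ a) (proj₁ b)))
    (subst (λ v → ∣ v ∣ᵥ < ∣ proj₁ a ∣ᵥ ℕ.+ ∣ proj₁ b ∣ᵥ) (=ᵥ-sound (proj₁ a) (proj₁ c) eq) (ℕ.m<m+n _ (∣NZ∣>0 b))))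

Tη-δᶜ : ∀ I (J : Comp ℓ) → Tη (δᶜ J) I ≡ ηcoef I J
Tη-δᶜ {ℓ} [] [] rewrite =ᵥ-refl (0ᵥ {ℓ}) = refl
Tη-δᶜ [] (_ ∷ _) = refl
Tη-δᶜ (a ∷ I) J = W₁-δᶜ 0ᵥ a a (+ᵥ-identityˡ _) I J

⟪,η⟫-Tη : ∀ x (J : Comp ℓ) → ⟪ x ,η J ⟫ ≡ Tη (coeff x) J
⟪,η⟫-Tη x J = begin
  apply (ηcoef J) x ≡⟨ apply-cong (λ K → sym (Tη-δᶜ J K)) x ⟩
  apply (λ K → Tη (δᶜ K) J) x ≡⟨ apply-cong (λ K → W-cong 2ℚ 1ℚ (λ I → δ-sym I K) J) x ⟩
  apply (λ K → Tη δ⟨ K ⟩ J) x ≡⟨ W-apply 2ℚ 1ℚ δ⟨_⟩ x J ⟨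
  Tη (coeff x) J ∎

-- The form in which the basis property of the η is used: `Sη` recovers an element of `NSym` from
-- its pairings with them.
≈-from-Tη : (x y : NSym ℓ) → Tη (coeff x) ≗ Tη (coeff y) → x ≈ y
≈-from-Tη x y eq I = begin
  coeff x I ≡⟨ Sη-Tη (coeff x) I ⟨
  Sη (Tη (coeff x)) I ≡⟨ W-cong ½ (- ½) eq I ⟩
  Sη (Tη (coeff y)) I ≡⟨ Sη-Tη (coeff y) I ⟩
  coeff y I ∎

-- `h` is known only through its coefficients; `L >>= WLin 2ℚ 1ℚ` is an explicit list with the same
-- ones, so `apply-≈` transfers the value.
apply-η : (φ : Functional ℓ) → ∀ h L → (∀ J → coeff h J ≡ apply (λ I → ηcoef I J) L) → apply φ h ≡ apply (Tη φ) L
apply-η φ h L h≡ = begin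
  apply φ h ≡⟨ apply-≈ φ {h} {L >>= WLin 2ℚ 1ℚ} (λ J → trans (h≡ J) (sym (trans (expand (δᶜ J)) (apply-cong (λ I → Tη-δᶜ I J) L)))) ⟩
  apply φ (L >>= WLin 2ℚ 1ℚ) ≡⟨ expand φ ⟩
  apply (Tη φ) L ∎
  where
  expand : ∀ φ → apply φ (L >>= WLin 2ℚ 1ℚ) ≡ apply (Tη φ) L
  expand φ = trans (apply->>= φ L (WLin 2ℚ 1ℚ)) (apply-cong (apply-WLin 2ℚ 1ℚ φ) L)

-- Homogeneous components

-- Shaped so that `IsRestriction φ n x` unfolds to `coeff x ≗ (φ ∣ n)`.
_∣_ : Functional ℓ → Vec ℕ ℓ → Functional ℓ
(φ ∣ n) I = if deg I =ᵥ n then φ I else 0ℚ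

∣-yes : (φ : Functional ℓ) → ∀ {n} I → deg I ≡ n → (φ ∣ n) I ≡ φ I
∣-yes φ I refl rewrite =ᵥ-refl (deg I) = refl

∣-no : (φ : Functional ℓ) → ∀ {n} I → deg I ≢ n → (φ ∣ n) I ≡ 0ℚ
∣-no φ {n} I deg≢n rewrite =ᵥ-complete (deg I) n deg≢n = refl

W-∣ : ∀ p q (φ : Functional ℓ) n → W p q (φ ∣ n) ≗ (W p q φ ∣ n)
W-∣ p q φ n I with deg I ≟ᵥ n
... | yes deg≡n = trans (W-local p q I λ J eq → ∣-yes φ J (trans eq deg≡n)) (sym (∣-yes (W p q φ) I deg≡n))
... | no deg≢n = trans (trans (W-local p q I λ J eq → ∣-no φ J (deg≢n ∘ trans (sym eq))) (W-zero p q I)) (sym (∣-no (W p q φ) I deg≢n))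

apply-component : (φ : Functional ℓ) → ∀ n x → apply φ (component n x) ≡ apply (φ ∣ n) x
apply-component φ n x = trans (∑-map _ _ x) (∑-cong (λ (q , J) → pointwise q J (deg J =ᵥ n)) x)
  where
  pointwise : ∀ q J b → q * δ b * φ J ≡ q * (if b then φ J else 0ℚ)
  pointwise q J true = cong (_* φ J) (*-identityʳ q)
  pointwise q J false = trans (cong (_* φ J) (*-zeroʳ q)) (trans (*-zeroˡ (φ J)) (sym (*-zeroʳ q)))

coeff-component : ∀ n (x : Lin ℓ) K → coeff (component n x) K ≡ (coeff x ∣ n) K
coeff-component n x K = trans (apply-component (δᶜ K) n x) (pointwise (deg K ≟ᵥ n))
  where
  off : deg K ≢ n → ∀ J → (δᶜ K ∣ n) J ≡ 0ℚ
  off deg≢n J with deg J ≟ᵥ n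
  ... | yes deg≡n = trans (∣-yes (δᶜ K) J deg≡n) (δ-≢ J K λ { refl → deg≢n deg≡n })
  ... | no deg≢n = ∣-no (δᶜ K) J deg≢n
  on : deg K ≡ n → ∀ J → (δᶜ K ∣ n) J ≡ δᶜ K J
  on deg≡n J with deg J ≟ᵥ n
  ... | yes degJ≡n = ∣-yes (δᶜ K) J degJ≡n
  ... | no degJ≢n = trans (∣-no (δᶜ K) J degJ≢n) (sym (δ-≢ J K λ { refl → degJ≢n deg≡n }))
  pointwise : Dec (deg K ≡ n) → apply (δᶜ K ∣ n) x ≡ (coeff x ∣ n) K
  pointwise (yes deg≡n) = trans (apply-cong (on deg≡n) x) (sym (∣-yes (coeff x) K deg≡n))
  pointwise (no deg≢n) = trans (trans (apply-cong (off deg≢n) x) (apply-zero x)) (sym (∣-no (coeff x) K deg≢n))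

-- Functionals of one degree as elements of `NSym`

-- Calling `without J` makes repetitions in the index list harmless, so the enumeration fed to it
-- need not be duplicate-free.
fromFunctional : Functional ℓ → List (Comp ℓ) → NSym ℓ
fromFunctional φ [] = []
fromFunctional φ (J ∷ Js) = (φ J , J) ∷ without J (fromFunctional φ Js)

coeff-fromFunctional : (φ : Functional ℓ) → ∀ Js K → coeff (fromFunctional φ Js) K ≡ φ K ⊎ (coeff (fromFunctional φ Js) K ≡ 0ℚ × K ∉ Js)
coeff-fromFunctional φ [] K = inj₂ (refl , λ ())
coeff-fromFunctional φ (J ∷ Js) K with J ≟ᶜ K
... | yes refl = inj₁ (begin
  φ J * δ (J =ᶜ J) + coeff (without J (fromFunctional φ Js)) J
    ≡⟨ cong₂ (λ d c → φ J * d + c) (δ-refl J) (coeff-filter-no (J ≢?_) (λ J≢J → J≢J refl) (fromFunctional φ Js)) ⟩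
  φ J * 1ℚ + 0ℚ ≡⟨ trans (+-identityʳ _) (*-identityʳ (φ J)) ⟩
  φ J ∎)
... | no J≢K = Sum.map (trans tail) (λ (≡0 , K∉Js) → trans tail ≡0 , λ { (here refl) → J≢K refl ; (there K∈Js) → K∉Js K∈Js }) (coeff-fromFunctional φ Js K)
  where
  tail : φ J * δ (J =ᶜ K) + coeff (without J (fromFunctional φ Js)) K ≡ coeff (fromFunctional φ Js) K
  tail = begin
    φ J * δ (J =ᶜ K) + coeff (without J (fromFunctional φ Js)) K
      ≡⟨ cong₂ (λ d c → φ J * d + c) (δ-≢ J K J≢K) (coeff-filter-yes (J ≢?_) J≢K (fromFunctional φ Js)) ⟩
    φ J * 0ℚ + coeff (fromFunctional φ Js) K ≡⟨ trans (cong (_+ coeff (fromFunctional φ Js) K) (*-zeroʳ (φ J))) (+-identityˡ _) ⟩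
    coeff (fromFunctional φ Js) K ∎

vectors : ∀ ℓ → ℕ → List (Vec ℕ ℓ)
vectors zero m = [] ∷ []
vectors (suc ℓ) m = cartesianProductWith _∷_ (upTo (suc m)) (vectors ℓ m)

∈-vectors : ∀ {m} (v : Vec ℕ ℓ) → ∣ v ∣ᵥ ≤ m → v ∈ vectors ℓ m
∈-vectors [] _ = here refl
∈-vectors (x ∷ v) ∣v∣≤m = ∈-cartesianProductWith⁺ _∷_ (∈-upTo⁺ (s≤s (ℕ.m+n≤o⇒m≤o x ∣v∣≤m))) (∈-vectors v (ℕ.m+n≤o⇒n≤o x ∣v∣≤m))

toNZ : Vec ℕ ℓ → List (NZ ℓ)
toNZ v with T? (nz? v)
... | yes nz = (v , nz) ∷ []
... | no _ = []

∈-toNZ : (a : NZ ℓ) → a ∈ toNZ (proj₁ a)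
∈-toNZ (v , nz) with T? (nz? v)
... | yes _ = here (NZ-≡ refl)
... | no ¬nz = ⊥-elim (¬nz nz)

-- Here `m` bounds the entries of the columns and `f` the number of columns. Columns have size at
-- least 1, so `∣ n ∣ᵥ` serves as both bounds in degree `n`; surplus compositions receive the value
-- 0 from `φ ∣ n`.
compositions : ℕ → ℕ → List (Comp ℓ)
compositions m zero = [] ∷ []
compositions m (suc f) = [] ∷ cartesianProductWith _∷_ (concatMap toNZ (vectors _ m)) (compositions m f)

∣deg∷∣ : (a : NZ ℓ) → ∀ I → ∣ deg (a ∷ I) ∣ᵥ ≡ ∣ proj₁ a ∣ᵥ ℕ.+ ∣ deg I ∣ᵥ
∣deg∷∣ a I = ∣+ᵥ∣ (proj₁ a) (deg I)

∈-compositions : ∀ {m f} (I : Comp ℓ) → ∣ deg I ∣ᵥ ≤ m → ∣ deg I ∣ᵥ ≤ f → I ∈ compositions m f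
∈-compositions {f = zero} [] _ _ = here refl
∈-compositions {f = suc f} [] _ _ = here refl
∈-compositions {m = m} {f = f} (a ∷ I) ≤m ≤f rewrite ∣deg∷∣ a I = step f ≤f
  where
  step : ∀ f → ∣ proj₁ a ∣ᵥ ℕ.+ ∣ deg I ∣ᵥ ≤ f → a ∷ I ∈ compositions m f
  step zero ≤f = ⊥-elim (ℕ.<⇒≱ (ℕ.<-≤-trans (∣NZ∣>0 a) (ℕ.m≤m+n _ _)) ≤f)
  step (suc f) ≤f = there (∈-cartesianProductWith⁺ _∷_
    (∈-concatMap⁺ toNZ (Any.map (λ { refl → ∈-toNZ a }) (∈-vectors (proj₁ a) (ℕ.m+n≤o⇒m≤o _ ≤m))))
    (∈-compositions I (ℕ.m+n≤o⇒n≤o ∣ proj₁ a ∣ᵥ ≤m) (ℕ.≤-pred (ℕ.≤-trans (ℕ.+-monoˡ-≤ ∣ deg I ∣ᵥ (∣NZ∣>0 a)) ≤f))))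

restrict : Functional ℓ → Vec ℕ ℓ → NSym ℓ
restrict φ n = fromFunctional (φ ∣ n) (compositions ∣ n ∣ᵥ ∣ n ∣ᵥ)

coeff-restrict : (φ : Functional ℓ) → ∀ n → coeff (restrict φ n) ≗ (φ ∣ n)
coeff-restrict φ n K with coeff-fromFunctional (φ ∣ n) (compositions ∣ n ∣ᵥ ∣ n ∣ᵥ) K
... | inj₁ eq = eq
... | inj₂ (≡0 , K∉) = trans ≡0 (sym (∣-no φ K λ { refl → K∉ (∈-compositions K ℕ.≤-refl ℕ.≤-refl) }))

-- The functional ζ̄ − ζ⁻¹ in η-coordinates

sign-suc : ∀ n → sign (suc n) ≡ - sign n
sign-suc zero = refl
sign-suc (suc zero) = refl
sign-suc (suc (suc n)) = sign-suc n

sign-+ : ∀ m n → sign (m ℕ.+ n) ≡ sign m * sign n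
sign-+ zero n = sym (*-identityˡ _)
sign-+ (suc m) n = begin
  sign (suc (m ℕ.+ n)) ≡⟨ sign-suc (m ℕ.+ n) ⟩
  - sign (m ℕ.+ n) ≡⟨ cong -_ (sign-+ m n) ⟩
  - (sign m * sign n) ≡⟨ ℚ.neg-distribˡ-* (sign m) (sign n) ⟩
  - sign m * sign n ≡⟨ cong (_* sign n) (sign-suc m) ⟨
  sign (suc m) * sign n ∎

sign-even : ∀ n → n % 2 ≡ 0 → sign n ≡ 1ℚ
sign-even n even rewrite even = refl

sign-odd : ∀ n → n % 2 ≡ 1 → sign n ≡ - 1ℚ
sign-odd n odd rewrite odd = refl

-- Once one column is consumed, `ζQ` is 1 on `[]` and 0 elsewhere, which is the unit for
-- convolution. The recursion for the inverse thus only flips the sign for each column.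
ζQ∷-⋆ : (ψ : Functional ℓ) → ∀ a I → ((ζQ ∘ (a ∷_)) ⋆ ψ) I ≡ ψ I
ζQ∷-⋆ ψ a [] = trans (+-identityʳ _) (*-identityˡ (ψ []))
ζQ∷-⋆ ψ a (b ∷ I) = begin
  ((ζQ ∘ (a ∷_)) ⋆ ψ) (b ∷ I) ≡⟨ ⋆-cons (ζQ ∘ (a ∷_)) ψ b I ⟩
  1ℚ * ψ (b ∷ I) + ((λ _ → 0ℚ) ⋆ ψ) I ≡⟨ cong₂ _+_ (*-identityˡ (ψ (b ∷ I))) (⋆-zeroˡ ψ I) ⟩
  ψ (b ∷ I) + 0ℚ ≡⟨ +-identityʳ _ ⟩
  ψ (b ∷ I) ∎

ζQ⁻¹-sign : (I : Comp ℓ) → (ζQ ⁻¹⋆) I ≡ sign (len I)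
ζQ⁻¹-sign [] = refl
ζQ⁻¹-sign (a ∷ I) = begin
  (ζQ ⁻¹⋆) (a ∷ I) ≡⟨ cong -_ (∑-map _ _ (splits I)) ⟩
  - ((ζQ ∘ (a ∷_)) ⋆ inv-go ζQ (len I)) I ≡⟨ cong -_ (ζQ∷-⋆ (inv-go ζQ (len I)) a I) ⟩
  - (ζQ ⁻¹⋆) I ≡⟨ cong -_ (ζQ⁻¹-sign I) ⟩
  - sign (len I) ≡⟨ sign-suc (len I) ⟨
  sign (len (a ∷ I)) ∎

-- `ζ̄Q` vanishes on two or more columns, so only the coarsening to a single column survives, with
-- weight 2.
W₁-ζ̄Q : (a : NZ ℓ) → ∀ I → W₁ 2ℚ 1ℚ ζ̄Q a I ≡ 2ℚ * sign ∣ deg (a ∷ I) ∣ᵥ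
W₁-ζ̄Q a [] = cong (2ℚ *_) (*-identityʳ (sign ∣ deg (a ∷ []) ∣ᵥ))
W₁-ζ̄Q a (b ∷ I) = begin
  2ℚ * W₁ 2ℚ 1ℚ (ζ̄Q ∘ (a ∷_)) b I + 1ℚ * W₁ 2ℚ 1ℚ ζ̄Q (a ⊹ b) I
    ≡⟨ cong₂ (λ s t → 2ℚ * s + 1ℚ * t) (W₁-zero 2ℚ 1ℚ (λ c J → *-zeroʳ (sign ∣ deg (a ∷ c ∷ J) ∣ᵥ)) b I) (W₁-ζ̄Q (a ⊹ b) I) ⟩
  2ℚ * 0ℚ + 1ℚ * (2ℚ * sign ∣ deg (a ⊹ b ∷ I) ∣ᵥ)
    ≡⟨ trans (+-identityˡ _) (*-identityˡ _) ⟩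
  2ℚ * sign ∣ deg (a ⊹ b ∷ I) ∣ᵥ
    ≡⟨ cong (λ v → 2ℚ * sign ∣ v ∣ᵥ) (deg-⊹ a b I) ⟩
  2ℚ * sign ∣ deg (a ∷ b ∷ I) ∣ᵥ ∎

-- With the sign included, a kept gap weighs -2 and a closed one 1, so each gap contributes -1; the
-- extra factor of a nonempty composition is -2.
W₁-sign-len : (a : NZ ℓ) → ∀ I → W₁ 2ℚ 1ℚ (sign ∘ len) a I ≡ 2ℚ * sign (suc (len I))
W₁-sign-len a [] = refl
W₁-sign-len {ℓ} a (b ∷ I) = begin
  2ℚ * W₁ 2ℚ 1ℚ (s ∘ (a ∷_)) b I + 1ℚ * W₁ 2ℚ 1ℚ s (a ⊹ b) I
    ≡⟨ cong (λ t → 2ℚ * t + 1ℚ * W₁ 2ℚ 1ℚ s (a ⊹ b) I) (trans (W₁-local 2ℚ 1ℚ b I λ c J _ → negate (c ∷ J)) (W₁-linear 2ℚ 1ℚ (- 1ℚ) 0ℚ s s b I)) ⟩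
  2ℚ * ((- 1ℚ) * W₁ 2ℚ 1ℚ s b I + 0ℚ * W₁ 2ℚ 1ℚ s b I) + 1ℚ * W₁ 2ℚ 1ℚ s (a ⊹ b) I
    ≡⟨ cong₂ (λ t u → 2ℚ * ((- 1ℚ) * t + 0ℚ * t) + 1ℚ * u) (W₁-sign-len b I) (W₁-sign-len (a ⊹ b) I) ⟩
  2ℚ * ((- 1ℚ) * (2ℚ * σ) + 0ℚ * (2ℚ * σ)) + 1ℚ * (2ℚ * σ)
    ≡⟨ solve 1 (λ σ → con 2ℚ :* ((:- con 1ℚ) :* (con 2ℚ :* σ) :+ con 0ℚ :* (con 2ℚ :* σ)) :+ con 1ℚ :* (con 2ℚ :* σ) := con 2ℚ :* (:- σ)) refl σ ⟩
  2ℚ * - σ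
    ≡⟨ cong (2ℚ *_) (sign-suc (suc (len I))) ⟨
  2ℚ * sign (suc (suc (len I))) ∎
  where
  s : Functional ℓ
  s = sign ∘ len
  σ : ℚ
  σ = sign (suc (len I))
  -- The zero summand brings a scalar multiple into the two-term shape of `W₁-linear`.
  negate : ∀ J → sign (suc (len J)) ≡ (- 1ℚ) * s J + 0ℚ * s J
  negate J = trans (sign-suc (len J)) (solve 1 (λ t → :- t := (:- con 1ℚ) :* t :+ con 0ℚ :* t) refl (s J))

γ : Functional ℓ
γ I = ζ̄Q I + - (ζQ ⁻¹⋆) I

Tη-γ : (I : Comp ℓ) → Tη γ I ≡ 2ℚ * (sign ∣ deg I ∣ᵥ + - sign (len I))
-- On the empty composition both terms are 1 instead of 2, but their difference is still 0.
Tη-γ {ℓ} [] rewrite ∣0ᵥ∣ ℓ = refl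
Tη-γ (a ∷ I) = begin
  W₁ 2ℚ 1ℚ γ a I
    ≡⟨ W₁-local 2ℚ 1ℚ a I (λ b J _ → trans (cong (λ t → ζ̄Q (b ∷ J) + - t) (ζQ⁻¹-sign (b ∷ J))) (solve 2 (λ s t → s :+ :- t := con 1ℚ :* s :+ (:- con 1ℚ) :* t) refl (ζ̄Q (b ∷ J)) (sign (suc (len J))))) ⟩
  W₁ 2ℚ 1ℚ (λ J → 1ℚ * ζ̄Q J + (- 1ℚ) * sign (len J)) a I
    ≡⟨ W₁-linear 2ℚ 1ℚ 1ℚ (- 1ℚ) ζ̄Q (sign ∘ len) a I ⟩
  1ℚ * W₁ 2ℚ 1ℚ ζ̄Q a I + (- 1ℚ) * W₁ 2ℚ 1ℚ (sign ∘ len) a I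
    ≡⟨ cong₂ (λ s t → 1ℚ * s + (- 1ℚ) * t) (W₁-ζ̄Q a I) (W₁-sign-len a I) ⟩
  1ℚ * (2ℚ * sign ∣ deg (a ∷ I) ∣ᵥ) + (- 1ℚ) * (2ℚ * sign (suc (len I)))
    ≡⟨ solve 2 (λ s t → con 1ℚ :* (con 2ℚ :* s) :+ (:- con 1ℚ) :* (con 2ℚ :* t) := con 2ℚ :* (s :+ :- t)) refl (sign ∣ deg (a ∷ I) ∣ᵥ) (sign (suc (len I))) ⟩
  2ℚ * (sign ∣ deg (a ∷ I) ∣ᵥ + - sign (len (a ∷ I))) ∎

apply-γ : (h : QSym ℓ) → apply γ h ≡ apply ζ̄Q h + (- 1ℚ) * apply (ζQ ⁻¹⋆) h
apply-γ h = begin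
  apply γ h ≡⟨ apply-cong (λ I → cong (ζ̄Q I +_) (solve 1 (λ t → :- t := (:- con 1ℚ) :* t) refl ((ζQ ⁻¹⋆) I))) h ⟩
  apply (λ I → ζ̄Q I + (- 1ℚ) * (ζQ ⁻¹⋆) I) h ≡⟨ apply-+ ζ̄Q (λ I → (- 1ℚ) * (ζQ ⁻¹⋆) I) h ⟩
  apply ζ̄Q h + apply (λ I → (- 1ℚ) * (ζQ ⁻¹⋆) I) h ≡⟨ cong (apply ζ̄Q h +_) (apply-*ˡ (- 1ℚ) (ζQ ⁻¹⋆) h) ⟩
  apply ζ̄Q h + (- 1ℚ) * apply (ζQ ⁻¹⋆) h ∎

-- Admissible compositions

≤∞-monoˡ : ∀ {m n} k → m ≤ n → n ≤∞ k → m ≤∞ k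
≤∞-monoˡ (fin k) m≤n n≤k = ℕ.≤-trans m≤n n≤k
≤∞-monoˡ ∞ _ _ = tt

+ᵥ-≤ᵥ : (v w : Vec ℕ ℓ) → ∀ k → (v +ᵥ w) ≤ᵥ k → v ≤ᵥ k × w ≤ᵥ k
+ᵥ-≤ᵥ v w k v+w≤k = (λ i → ≤∞-monoˡ (lookup k i) (ℕ.m≤m+n _ _) (sum≤k i)) , (λ i → ≤∞-monoˡ (lookup k i) (ℕ.m≤n+m _ (lookup v i)) (sum≤k i))
  where
  sum≤k : ∀ i → (lookup v i ℕ.+ lookup w i) ≤∞ lookup k i
  sum≤k i = subst (_≤∞ lookup k i) (Vec.lookup-zipWith ℕ._+_ i v w) (v+w≤k i)

_≤∞?_ : ∀ m k → Dec (m ≤∞ k)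
m ≤∞? fin k = m ℕ.≤? k
m ≤∞? ∞ = yes tt

_≤ᵥ?_ : (v : Vec ℕ ℓ) (k : Vec ℕ∞ ℓ) → Dec (v ≤ᵥ k)
v ≤ᵥ? k = all? λ i → lookup v i ≤∞? lookup k i

admissible? : (k : Vec ℕ∞ ℓ) → Decidable (Admissible k)
admissible? k = All.all? λ a → (proj₁ a ≤ᵥ? k) →-dec (∣ proj₁ a ∣ᵥ % 2 ℕ.≟ 1)

-- Every part is below `deg I`, hence below `k`, so admissibility makes every part odd and each
-- contributes -1 to both signs.
admissible-sign : (k : Vec ℕ∞ ℓ) → ∀ I → deg I ≤ᵥ k → Admissible k I → sign ∣ deg I ∣ᵥ ≡ sign (len I)
admissible-sign {ℓ} k [] _ _ = cong sign (∣0ᵥ∣ ℓ)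
admissible-sign k (a ∷ I) deg≤k (odd ∷ adm) = begin
  sign ∣ deg (a ∷ I) ∣ᵥ ≡⟨ cong sign (∣deg∷∣ a I) ⟩
  sign (∣ proj₁ a ∣ᵥ ℕ.+ ∣ deg I ∣ᵥ) ≡⟨ sign-+ ∣ proj₁ a ∣ᵥ ∣ deg I ∣ᵥ ⟩
  sign ∣ proj₁ a ∣ᵥ * sign ∣ deg I ∣ᵥ ≡⟨ cong₂ _*_ (sign-odd ∣ proj₁ a ∣ᵥ (odd (proj₁ parts≤k))) (admissible-sign k I (proj₂ parts≤k) adm) ⟩
  (- 1ℚ) * sign (len I) ≡⟨ solve 1 (λ t → (:- con 1ℚ) :* t := :- t) refl (sign (len I)) ⟩
  - sign (len I) ≡⟨ sign-suc (len I) ⟨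
  sign (len (a ∷ I)) ∎
  where
  parts≤k : proj₁ a ≤ᵥ k × deg I ≤ᵥ k
  parts≤k = +ᵥ-≤ᵥ (proj₁ a) (deg I) k deg≤k

Tη-γ∣-admissible : (k : Vec ℕ∞ ℓ) → ∀ {n} → n ≤ᵥ k → ∀ I → Admissible k I → (Tη γ ∣ n) I ≡ 0ℚ
Tη-γ∣-admissible k {n} n≤k I adm with deg I ≟ᵥ n
... | no deg≢n = ∣-no (Tη γ) I deg≢n
... | yes refl = begin
  (Tη γ ∣ n) I ≡⟨ ∣-yes (Tη γ) I refl ⟩
  Tη γ I ≡⟨ Tη-γ I ⟩
  2ℚ * (sign ∣ deg I ∣ᵥ + - sign (len I)) ≡⟨ cong (λ t → 2ℚ * (t + - sign (len I))) (admissible-sign k I n≤k adm) ⟩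
  2ℚ * (sign (len I) + - sign (len I)) ≡⟨ cong (2ℚ *_) (ℚ.+-inverseʳ (sign (len I))) ⟩
  0ℚ ∎

-- The decomposition is the one needed to factor Υ^I as a product with the middle factor Υ of
-- `part`.
record EvenPart (k : Vec ℕ∞ ℓ) (I : Comp ℓ) : Set where
  constructor evenPart
  field
    before : Comp ℓ
    part : NZ ℓ
    after : Comp ℓ
    decomposition : I ≡ before ++ part ∷ after
    part≤k : proj₁ part ≤ᵥ k
    even : ∣ proj₁ part ∣ᵥ % 2 ≡ 0

%2≢1⇒%2≡0 : ∀ n → n % 2 ≢ 1 → n % 2 ≡ 0
%2≢1⇒%2≡0 n ≢1 with n % 2 | m%n<n n 2
... | zero | _ = refl
... | suc zero | _ = ⊥-elim (≢1 refl)
... | suc (suc _) | s≤s (s≤s ())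

inadmissible⇒EvenPart : (k : Vec ℕ∞ ℓ) → ∀ I → ¬ Admissible k I → EvenPart k I
inadmissible⇒EvenPart k [] ¬adm = ⊥-elim (¬adm [])
inadmissible⇒EvenPart k (a ∷ I) ¬adm with proj₁ a ≤ᵥ? k | ∣ proj₁ a ∣ᵥ % 2 ℕ.≟ 1
... | yes a≤k | no ¬odd = evenPart [] a I refl a≤k (%2≢1⇒%2≡0 ∣ proj₁ a ∣ᵥ ¬odd)
... | no a≰k | _ with inadmissible⇒EvenPart k I (λ adm → ¬adm ((λ a≤k → ⊥-elim (a≰k a≤k)) ∷ adm))
...   | evenPart I′ b I″ eq b≤k even = evenPart (a ∷ I′) b I″ (cong (a ∷_) eq) b≤k even
inadmissible⇒EvenPart k (a ∷ I) ¬adm | yes _ | yes odd with inadmissible⇒EvenPart k I (λ adm → ¬adm ((λ _ → odd) ∷ adm))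
...   | evenPart I′ b I″ eq b≤k even = evenPart (a ∷ I′) b I″ (cong (a ∷_) eq) b≤k even

∣deg-++∣ : (I J : Comp ℓ) → ∣ deg (I ++ J) ∣ᵥ ≡ ∣ deg I ∣ᵥ ℕ.+ ∣ deg J ∣ᵥ
∣deg-++∣ {ℓ} [] J = cong (ℕ._+ ∣ deg J ∣ᵥ) (sym (∣0ᵥ∣ ℓ))
∣deg-++∣ (a ∷ I) J = begin
  ∣ deg (a ∷ I ++ J) ∣ᵥ ≡⟨ ∣deg∷∣ a (I ++ J) ⟩
  ∣ proj₁ a ∣ᵥ ℕ.+ ∣ deg (I ++ J) ∣ᵥ ≡⟨ cong (∣ proj₁ a ∣ᵥ ℕ.+_) (∣deg-++∣ I J) ⟩
  ∣ proj₁ a ∣ᵥ ℕ.+ (∣ deg I ∣ᵥ ℕ.+ ∣ deg J ∣ᵥ) ≡⟨ ℕ.+-assoc ∣ proj₁ a ∣ᵥ _ _ ⟨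
  ∣ proj₁ a ∣ᵥ ℕ.+ ∣ deg I ∣ᵥ ℕ.+ ∣ deg J ∣ᵥ ≡⟨ cong (ℕ._+ ∣ deg J ∣ᵥ) (∣deg∷∣ a I) ⟨
  ∣ deg (a ∷ I) ∣ᵥ ℕ.+ ∣ deg J ∣ᵥ ∎

∣deg∷∣>0 : (a : NZ ℓ) → ∀ I → 0 < ∣ deg (a ∷ I) ∣ᵥ
∣deg∷∣>0 a I = subst (0 <_) (sym (∣deg∷∣ a I)) (ℕ.<-≤-trans (∣NZ∣>0 a) (ℕ.m≤m+n _ _))

-- Any column besides `b` is nonzero and uses up some of the degree. This supplies the descent for
-- the induction on the size of `n`.
part-smaller : (I : Comp ℓ) (b n : NZ ℓ) (J : Comp ℓ) → deg (I ++ b ∷ J) ≡ proj₁ n → I ++ b ∷ J ≢ n ∷ [] → ∣ proj₁ b ∣ᵥ < ∣ proj₁ n ∣ᵥ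
part-smaller I b n J deg≡n ≢n = subst (∣ proj₁ b ∣ᵥ <_) (trans (sym size) (cong ∣_∣ᵥ deg≡n)) (bound I J deg≡n ≢n)
  where
  size : ∣ deg (I ++ b ∷ J) ∣ᵥ ≡ ∣ deg I ∣ᵥ ℕ.+ (∣ proj₁ b ∣ᵥ ℕ.+ ∣ deg J ∣ᵥ)
  size = trans (∣deg-++∣ I (b ∷ J)) (cong (∣ deg I ∣ᵥ ℕ.+_) (∣deg∷∣ b J))
  bound : ∀ I J → deg (I ++ b ∷ J) ≡ proj₁ n → I ++ b ∷ J ≢ n ∷ [] → ∣ proj₁ b ∣ᵥ < ∣ deg I ∣ᵥ ℕ.+ (∣ proj₁ b ∣ᵥ ℕ.+ ∣ deg J ∣ᵥ)
  bound [] [] deg≡n ≢n = ⊥-elim (≢n (cong (_∷ []) (NZ-≡ (trans (sym (+ᵥ-identityʳ (proj₁ b))) deg≡n))))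
  bound I (c ∷ J) _ _ = ℕ.<-≤-trans (ℕ.m<m+n _ (∣deg∷∣>0 c J)) (ℕ.m≤n+m _ ∣ deg I ∣ᵥ)
  bound (c ∷ I) J _ _ = ℕ.≤-<-trans (ℕ.m≤m+n _ ∣ deg J ∣ᵥ) (ℕ.m<n+m _ (∣deg∷∣>0 c I))

-- Ideals of NSym

·-⊕ʳ : (z x y : NSym ℓ) → (z · (x ⊕ y)) ≈ ((z · x) ⊕ (z · y))
·-⊕ʳ z x y I = begin
  coeff (z · (x ⊕ y)) I ≡⟨ coeff-· z (x ⊕ y) I ⟩
  (coeff z ⋆ coeff (x ⊕ y)) I ≡⟨ ⋆-cong {φ = coeff z} (λ _ → refl) (λ J → apply-++ (δᶜ J) x y) I ⟩
  (coeff z ⋆ (λ J → coeff x J + coeff y J)) I ≡⟨ ⋆-distribˡ-+ (coeff z) (coeff x) (coeff y) I ⟩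
  (coeff z ⋆ coeff x) I + (coeff z ⋆ coeff y) I ≡⟨ cong₂ _+_ (coeff-· z x I) (coeff-· z y I) ⟨
  coeff (z · x) I + coeff (z · y) I ≡⟨ apply-++ (δᶜ I) (z · x) (z · y) ⟨
  coeff ((z · x) ⊕ (z · y)) I ∎

·-⊕ˡ : (z x y : NSym ℓ) → ((x ⊕ y) · z) ≈ ((x · z) ⊕ (y · z))
·-⊕ˡ z x y I = begin
  coeff ((x ⊕ y) · z) I ≡⟨ coeff-· (x ⊕ y) z I ⟩
  (coeff (x ⊕ y) ⋆ coeff z) I ≡⟨ ⋆-cong {ψ = coeff z} (λ J → apply-++ (δᶜ J) x y) (λ _ → refl) I ⟩
  ((λ J → coeff x J + coeff y J) ⋆ coeff z) I ≡⟨ ⋆-distribʳ-+ (coeff z) (coeff x) (coeff y) I ⟩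
  (coeff x ⋆ coeff z) I + (coeff y ⋆ coeff z) I ≡⟨ cong₂ _+_ (coeff-· x z I) (coeff-· y z I) ⟨
  coeff (x · z) I + coeff (y · z) I ≡⟨ apply-++ (δᶜ I) (x · z) (y · z) ⟨
  coeff ((x · z) ⊕ (y · z)) I ∎

·-cong : {x x′ y y′ : NSym ℓ} → x ≈ x′ → y ≈ y′ → (x · y) ≈ (x′ · y′)
·-cong {x = x} {x′} {y} {y′} x≈ y≈ I = trans (coeff-· x y I) (trans (⋆-cong x≈ y≈ I) (sym (coeff-· x′ y′ I)))

·-assoc : (x y z : NSym ℓ) → ((x · y) · z) ≈ (x · (y · z))
·-assoc x y z I = begin
  coeff ((x · y) · z) I ≡⟨ coeff-· (x · y) z I ⟩
  (coeff (x · y) ⋆ coeff z) I ≡⟨ ⋆-cong {ψ = coeff z} (coeff-· x y) (λ _ → refl) I ⟩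
  ((coeff x ⋆ coeff y) ⋆ coeff z) I ≡⟨ ⋆-assoc (coeff x) (coeff y) (coeff z) I ⟩
  (coeff x ⋆ (coeff y ⋆ coeff z)) I ≡⟨ ⋆-cong {φ = coeff x} (λ _ → refl) (coeff-· y z) I ⟨
  (coeff x ⋆ coeff (y · z)) I ≡⟨ coeff-· x (y · z) I ⟨
  coeff (x · (y · z)) I ∎

⊕-cong : {x x′ y y′ : NSym ℓ} → x ≈ x′ → y ≈ y′ → (x ⊕ y) ≈ (x′ ⊕ y′)
⊕-cong {x = x} {x′} {y} {y′} x≈ y≈ I = trans (apply-++ (δᶜ I) x y) (trans (cong₂ _+_ (x≈ I) (y≈ I)) (sym (apply-++ (δᶜ I) x′ y′)))

≈-sym : {x y : NSym ℓ} → x ≈ y → y ≈ x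
≈-sym x≈y I = sym (x≈y I)

≈-trans : {x y z : NSym ℓ} → x ≈ y → y ≈ z → x ≈ z
≈-trans x≈y y≈z I = trans (x≈y I) (y≈z I)

-- Shared by the generated ideals and by the annihilator of a subcoalgebra, so that the
-- factorisation of Υ^I is exploited once for both.
record IsIdeal (𝓘 : NSym ℓ → Set) : Set where
  field
    resp-≈ : ∀ {x y} → x ≈ y → 𝓘 x → 𝓘 y
    []-closed : 𝓘 []
    ⊕-closed : ∀ {x y} → 𝓘 x → 𝓘 y → 𝓘 (x ⊕ y)
    ·-closedˡ : ∀ z {x} → 𝓘 x → 𝓘 (z · x)
    ·-closedʳ : ∀ z {x} → 𝓘 x → 𝓘 (x · z)

  ·ₛ-closed : ∀ c {x} → 𝓘 x → 𝓘 (c ·ₛ x)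
  -- Scaling is left multiplication by `c` times the unit; the product list differs only by a
  -- trailing `++ []`.
  ·ₛ-closed c {x} x∈ = subst 𝓘 (++-identityʳ (c ·ₛ x)) (·-closedˡ ((c , []) ∷ []) x∈)

  >>=-closed : ∀ {L f} → All (λ qI → 𝓘 (f (proj₂ qI))) L → 𝓘 (L >>= f)
  >>=-closed [] = []-closed
  >>=-closed {(q , _) ∷ _} (fI∈ ∷ f∈) = ⊕-closed (·ₛ-closed q fI∈) (>>=-closed f∈)

module _ (P : NSym ℓ → Set) where

  private
    Triple : Set
    Triple = NSym ℓ × NSym ℓ × NSym ℓ

    ⟦_⟧ : Triple → NSym ℓ
    ⟦ t ⟧ = (proj₁ t · proj₁ (proj₂ t)) · proj₂ (proj₂ t)

    combination : List Triple → NSym ℓ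
    combination L = ΣLin (map ⟦_⟧ L)

    combination-++ : ∀ L L′ → combination (L ++ L′) ≡ combination L ++ combination L′
    combination-++ [] L′ = refl
    combination-++ (t ∷ L) L′ = trans (cong (⟦ t ⟧ ++_) (combination-++ L L′)) (sym (++-assoc ⟦ t ⟧ _ _))

    leftMul rightMul : NSym ℓ → Triple → Triple
    leftMul z (x , g , y) = (z · x , g , y)
    rightMul z (x , g , y) = (x , g , y · z)

    combination-leftMul : ∀ z L → (z · combination L) ≈ combination (map (leftMul z) L)
    combination-leftMul z [] I = trans (coeff-· z [] I) (⋆-zeroʳ (coeff z) I)
    combination-leftMul z (t@(x , g , y) ∷ L) = ≈-trans {x = z · (⟦ t ⟧ ⊕ combination L)} {(z · ⟦ t ⟧) ⊕ (z · combination L)} {⟦ leftMul z t ⟧ ⊕ combination (map (leftMul z) L)}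
      (·-⊕ʳ z ⟦ t ⟧ (combination L))
      (⊕-cong {x = z · ⟦ t ⟧} {⟦ leftMul z t ⟧} {z · combination L} {combination (map (leftMul z) L)}
        (≈-trans {x = z · ((x · g) · y)} {(z · (x · g)) · y} {((z · x) · g) · y}
          (≈-sym {x = (z · (x · g)) · y} {z · ((x · g) · y)} (·-assoc z (x · g) y))
          (·-cong {x = z · (x · g)} {(z · x) · g} {y} {y} (≈-sym {x = (z · x) · g} {z · (x · g)} (·-assoc z x g)) (λ _ → refl)))
        (combination-leftMul z L))

    combination-rightMul : ∀ z L → (combination L · z) ≈ combination (map (rightMul z) L)
    combination-rightMul z [] I = trans (coeff-· [] z I) (⋆-zeroˡ (coeff z) I)
    combination-rightMul z (t@(x , g , y) ∷ L) = ≈-trans {x = (⟦ t ⟧ ⊕ combination L) · z} {(⟦ t ⟧ · z) ⊕ (combination L · z)} {⟦ rightMul z t ⟧ ⊕ combination (map (rightMul z) L)}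
      (·-⊕ˡ z ⟦ t ⟧ (combination L))
      (⊕-cong {x = ⟦ t ⟧ · z} {⟦ rightMul z t ⟧} {combination L · z} {combination (map (rightMul z) L)} (·-assoc (x · g) y z) (combination-rightMul z L))

  InIdeal-isIdeal : IsIdeal (InIdeal P)
  InIdeal-isIdeal = record
    { resp-≈ = λ x≈y (L , gens , x≈L) → L , gens , λ I → trans (sym (x≈y I)) (x≈L I)
    ; []-closed = [] , [] , λ _ → refl
    ; ⊕-closed = λ {x} {y} (L , gens , x≈L) (L′ , gens′ , y≈L′) → L ++ L′ , ++⁺ gens gens′ ,
        λ I → trans (⊕-cong {x = x} {combination L} {y} {combination L′} x≈L y≈L′ I) (cong (λ z → coeff z I) (sym (combination-++ L L′)))
    ; ·-closedˡ = λ z {x} (L , gens , x≈L) → map (leftMul z) L , map⁺ gens ,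
        λ I → trans (·-cong {x = z} {z} {x} {combination L} (λ _ → refl) x≈L I) (combination-leftMul z L I)
    ; ·-closedʳ = λ z {x} (L , gens , x≈L) → map (rightMul z) L , map⁺ gens ,
        λ I → trans (·-cong {x = x} {combination L} {z} {z} x≈L (λ _ → refl) I) (combination-rightMul z L I)
    }

  InIdeal-least : {𝓘 : NSym ℓ → Set} → IsIdeal 𝓘 → (∀ {g} → P g → 𝓘 g) → ∀ {x} → InIdeal P x → 𝓘 x
  InIdeal-least {𝓘} ideal P⊆𝓘 {x} (L , gens , x≈L) = resp-≈ (≈-sym {x = x} {combination L} x≈L) (combination∈ gens)
    where
    open IsIdeal ideal
    combination∈ : ∀ {L} → All (λ t → P (proj₁ (proj₂ t))) L → 𝓘 (combination L)
    combination∈ [] = []-closed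
    combination∈ {(x , _ , y) ∷ L} (g∈P ∷ gens) = ⊕-closed (·-closedʳ y (·-closedˡ x (P⊆𝓘 g∈P))) (combination∈ gens)

  InIdeal-generator : ∀ {g} → P g → InIdeal P g
  InIdeal-generator {g} g∈P = (e [] , g , e []) ∷ [] , g∈P ∷ [] , λ I → sym (begin
    coeff (((e [] · g) · e []) ++ []) I ≡⟨ cong (λ z → coeff z I) (++-identityʳ ((e [] · g) · e [])) ⟩
    coeff ((e [] · g) · e []) I ≡⟨ coeff-· (e [] · g) (e []) I ⟩
    (coeff (e [] · g) ⋆ coeff (e [])) I ≡⟨ ⋆-cong (λ J → trans (cong (λ z → coeff z J) (++-identityʳ (1ℚ ·ₛ g))) (apply-·ₛ (δᶜ J) 1ℚ g)) (λ J → trans (+-identityʳ _) (*-identityˡ (δ⟨ [] ⟩ J))) I ⟩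
    ((λ J → 1ℚ * coeff g J) ⋆ δ⟨ [] ⟩) I ≡⟨ ⋆-cong {ψ = δ⟨ [] ⟩} (λ J → *-identityˡ (coeff g J)) (λ _ → refl) I ⟩
    (coeff g ⋆ δ⟨ [] ⟩) I ≡⟨ ⋆-δ[] (coeff g) I ⟩
    coeff g I ∎)
    where
    ⋆-δ[] : ∀ φ I → (φ ⋆ δ⟨ [] ⟩) I ≡ φ I
    ⋆-δ[] φ [] = trans (+-identityʳ _) (*-identityʳ (φ []))
    ⋆-δ[] φ (a ∷ I) = begin
      (φ ⋆ δ⟨ [] ⟩) (a ∷ I) ≡⟨ ⋆-cons φ δ⟨ [] ⟩ a I ⟩
      φ [] * 0ℚ + ((φ ∘ (a ∷_)) ⋆ δ⟨ [] ⟩) I ≡⟨ cong₂ _+_ (*-zeroʳ (φ [])) (⋆-δ[] (φ ∘ (a ∷_)) I) ⟩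
      0ℚ + φ (a ∷ I) ≡⟨ +-identityˡ _ ⟩
      φ (a ∷ I) ∎

-- The elements Υ^I

-- In η-coordinates Υ^I is the indicator of `I`; `Sη` converts it to M*-coordinates. The result is
-- homogeneous, so restricting to `deg I` gives a finite list and loses nothing.
Υ^ : Comp ℓ → NSym ℓ
Υ^ I = restrict (Sη δ⟨ I ⟩) (deg I)

coeff-Υ^ : (I : Comp ℓ) → coeff (Υ^ I) ≗ Sη δ⟨ I ⟩
coeff-Υ^ I J = begin
  coeff (Υ^ I) J ≡⟨ coeff-restrict (Sη δ⟨ I ⟩) (deg I) J ⟩
  (Sη δ⟨ I ⟩ ∣ deg I) J ≡⟨ W-∣ ½ (- ½) δ⟨ I ⟩ (deg I) J ⟨
  Sη (δ⟨ I ⟩ ∣ deg I) J ≡⟨ W-cong ½ (- ½) homogeneous J ⟩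
  Sη δ⟨ I ⟩ J ∎
  where
  homogeneous : (δ⟨ I ⟩ ∣ deg I) ≗ δ⟨ I ⟩
  homogeneous K with deg K ≟ᵥ deg I
  ... | yes deg≡ = ∣-yes δ⟨ I ⟩ K deg≡
  ... | no deg≢ = trans (∣-no δ⟨ I ⟩ K deg≢) (sym (δ-≢ I K λ { refl → deg≢ refl }))

Tη-Υ^ : (I : Comp ℓ) → Tη (coeff (Υ^ I)) ≗ δ⟨ I ⟩
Tη-Υ^ I J = trans (W-cong 2ℚ 1ℚ (coeff-Υ^ I) J) (Tη-Sη δ⟨ I ⟩ J)

Υ^-isΥ : (I : Comp ℓ) → IsΥ I (Υ^ I)
Υ^-isΥ I J = trans (⟪,η⟫-Tη (Υ^ I) J) (Tη-Υ^ I J)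

isΥ-unique : (I : Comp ℓ) → ∀ {x} → IsΥ I x → Υ^ I ≈ x
isΥ-unique I {x} isΥ = ≈-from-Tη (Υ^ I) x λ J → trans (Tη-Υ^ I J) (trans (sym (isΥ J)) (⟪,η⟫-Tη x J))

Υ^-++ : (I J : Comp ℓ) → (Υ^ I · Υ^ J) ≈ Υ^ (I ++ J)
Υ^-++ I J = ≈-from-Tη (Υ^ I · Υ^ J) (Υ^ (I ++ J)) λ K → begin
  Tη (coeff (Υ^ I · Υ^ J)) K ≡⟨ W-cong 2ℚ 1ℚ (coeff-· (Υ^ I) (Υ^ J)) K ⟩
  Tη (coeff (Υ^ I) ⋆ coeff (Υ^ J)) K ≡⟨ W-⋆ 2ℚ 1ℚ (coeff (Υ^ I)) (coeff (Υ^ J)) K ⟩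
  (Tη (coeff (Υ^ I)) ⋆ Tη (coeff (Υ^ J))) K ≡⟨ ⋆-cong (Tη-Υ^ I) (Tη-Υ^ J) K ⟩
  (δ⟨ I ⟩ ⋆ δ⟨ J ⟩) K ≡⟨ δ-⋆ I J K ⟩
  δ⟨ I ++ J ⟩ K ≡⟨ Tη-Υ^ (I ++ J) K ⟨
  Tη (coeff (Υ^ (I ++ J))) K ∎

-- By duality of the bases, the coefficient of `x` along Υ^I is its pairing with η_I, which is
-- `Tη (coeff x) I`.
Υ-expansion : (L : Lin ℓ) → ∀ x → coeff L ≗ Tη (coeff x) → (L >>= Υ^) ≈ x
Υ-expansion L x L≗ = ≈-from-Tη (L >>= Υ^) x λ K → begin
  Tη (coeff (L >>= Υ^)) K ≡⟨ W-cong 2ℚ 1ℚ (λ J → apply->>= (δᶜ J) L Υ^) K ⟩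
  Tη (λ J → apply (λ I → coeff (Υ^ I) J) L) K ≡⟨ W-apply 2ℚ 1ℚ (λ I → coeff (Υ^ I)) L K ⟩
  apply (λ I → Tη (coeff (Υ^ I)) K) L ≡⟨ apply-cong (λ I → Tη-Υ^ I K) L ⟩
  coeff L K ≡⟨ L≗ K ⟩
  Tη (coeff x) K ∎

module _ {𝓘 : NSym ℓ → Set} (ideal : IsIdeal 𝓘) where
  open IsIdeal ideal

  Υ^-part∈ : ∀ I b J → 𝓘 (Υ^ (b ∷ [])) → 𝓘 (Υ^ (I ++ b ∷ J))
  Υ^-part∈ I b J Υb∈ = resp-≈ (Υ^-++ I (b ∷ J)) (·-closedˡ (Υ^ I) (resp-≈ (Υ^-++ (b ∷ []) J) (·-closedʳ (Υ^ J) Υb∈)))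

-- The two generating sets

IOgen⊆⟨Υgen⟩ : (k : Vec ℕ∞ ℓ) → ∀ {x} → IOgen k x → InIdeal (Υgen k) x
IOgen⊆⟨Υgen⟩ {ℓ} k {x} (n , n≤k , x≡γ∣n) =
  resp-≈ {L >>= Υ^} {x} (Υ-expansion L x L≗) (>>=-closed {L} {Υ^} (All.map (λ {qI} → Υ∈ (proj₂ qI)) (all-filter (inadm? ∘ proj₂) L₀)))
  where
  open IsIdeal (InIdeal-isIdeal (Υgen k))
  inadm? : Decidable (λ I → ¬ Admissible k I)
  inadm? I = ¬? (admissible? k I)
  L₀ L : Lin ℓ
  L₀ = restrict (Tη γ) n
  -- The η-coordinates of `x` vanish at admissible compositions, so discarding those entries leaves
  -- a list whose every entry yields a member of the ideal.
  L = filter (inadm? ∘ proj₂) L₀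
  L≗ : coeff L ≗ Tη (coeff x)
  L≗ K = begin
    coeff L K ≡⟨ filter-≈ inadm? L₀ (λ K ¬¬adm → trans (coeff-restrict (Tη γ) n K) (Tη-γ∣-admissible k n≤k K (decidable-stable (admissible? k K) ¬¬adm))) K ⟩
    coeff L₀ K ≡⟨ coeff-restrict (Tη γ) n K ⟩
    (Tη γ ∣ n) K ≡⟨ W-∣ 2ℚ 1ℚ γ n K ⟨
    Tη (γ ∣ n) K ≡⟨ W-cong 2ℚ 1ℚ x≡γ∣n K ⟨
    Tη (coeff x) K ∎
  Υ∈ : ∀ I → ¬ Admissible k I → InIdeal (Υgen k) (Υ^ I)
  Υ∈ I ¬adm with inadmissible⇒EvenPart k I ¬adm
  ... | evenPart I′ b I″ refl b≤k even = Υ^-part∈ (InIdeal-isIdeal (Υgen k)) I′ b I″ (InIdeal-generator (Υgen k) {Υ^ (b ∷ [])} (b , b≤k , even , Υ^-isΥ (b ∷ [])))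

4ℚ : ℚ
4ℚ = 2ℚ * 2ℚ

-- Modulo Υ^I with a shorter even part, the generator of degree n is 4 Υ_n.
Υ^∈⟨IOgen⟩ : (k : Vec ℕ∞ ℓ) → ∀ m (n : NZ ℓ) → ∣ proj₁ n ∣ᵥ < m → proj₁ n ≤ᵥ k → ∣ proj₁ n ∣ᵥ % 2 ≡ 0 → InIdeal (IOgen k) (Υ^ (n ∷ []))
Υ^∈⟨IOgen⟩ {ℓ} k (suc m) n∷@(n , _) (s≤s ∣n∣≤m) n≤k even =
  resp-≈ {((½ * ½) ·ₛ G) ⊕ ((- (½ * ½)) ·ₛ z)} {Υ^ (n∷ ∷ [])} solve-for-Υ
    (⊕-closed {(½ * ½) ·ₛ G} {(- (½ * ½)) ·ₛ z} (·ₛ-closed (½ * ½) {G} G∈) (·ₛ-closed (- (½ * ½)) {z} z∈))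
  where
  open IsIdeal (InIdeal-isIdeal (IOgen k))
  G z : NSym ℓ
  G = restrict γ n
  -- The remainder of the generator; Υ_n is a quarter of `G` minus a quarter of `z`.
  z = G ⊕ ((- 4ℚ) ·ₛ Υ^ (n∷ ∷ []))
  G∈ : InIdeal (IOgen k) G
  G∈ = InIdeal-generator (IOgen k) {G} (n , n≤k , coeff-restrict γ n)

  coeff-z : ∀ K → coeff z K ≡ coeff G K + (- 4ℚ) * coeff (Υ^ (n∷ ∷ [])) K
  coeff-z K = trans (apply-++ (δᶜ K) G _) (cong (coeff G K +_) (apply-·ₛ (δᶜ K) (- 4ℚ) (Υ^ (n∷ ∷ []))))

  solve-for-Υ : (((½ * ½) ·ₛ G) ⊕ ((- (½ * ½)) ·ₛ z)) ≈ Υ^ (n∷ ∷ [])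
  solve-for-Υ K = begin
    coeff (((½ * ½) ·ₛ G) ⊕ ((- (½ * ½)) ·ₛ z)) K
      ≡⟨ trans (apply-++ (δᶜ K) ((½ * ½) ·ₛ G) _) (cong₂ _+_ (apply-·ₛ (δᶜ K) (½ * ½) G) (apply-·ₛ (δᶜ K) (- (½ * ½)) z)) ⟩
    (½ * ½) * coeff G K + (- (½ * ½)) * coeff z K
      ≡⟨ cong (λ t → (½ * ½) * coeff G K + (- (½ * ½)) * t) (coeff-z K) ⟩
    (½ * ½) * coeff G K + (- (½ * ½)) * (coeff G K + (- 4ℚ) * coeff (Υ^ (n∷ ∷ [])) K)
      ≡⟨ solve 2 (λ g u → con (½ * ½) :* g :+ con (- (½ * ½)) :* (g :+ con (- 4ℚ) :* u) := u) refl (coeff G K) (coeff (Υ^ (n∷ ∷ [])) K) ⟩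
    coeff (Υ^ (n∷ ∷ [])) K ∎

  P : Comp ℓ → Set
  -- Inadmissibility provides an even part below `k`; the other two conditions make that part
  -- strictly smaller than `n`.
  P I = ¬ Admissible k I × deg I ≡ n × n∷ ∷ [] ≢ I
  P? : Decidable P
  P? I = ¬? (admissible? k I) ×-dec ((deg I ≟ᵥ n) ×-dec ((n∷ ∷ []) ≢? I))
  L₀ L : Lin ℓ
  -- These are the η-coordinates of `z`. At the one-column composition, `Tη γ` is 2(1 - (-1)) = 4
  -- because the size is even and the length odd; the first entry cancels it.
  L₀ = (- 4ℚ , n∷ ∷ []) ∷ restrict (Tη γ) n
  L = filter (P? ∘ proj₂) L₀

  coeff-L₀ : ∀ K → coeff L₀ K ≡ (- 4ℚ) * δ⟨ n∷ ∷ [] ⟩ K + (Tη γ ∣ n) K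
  coeff-L₀ K = cong ((- 4ℚ) * δ⟨ n∷ ∷ [] ⟩ K +_) (coeff-restrict (Tη γ) n K)

  vanishes : ∀ K → ¬ P K → coeff L₀ K ≡ 0ℚ
  vanishes K ¬P = trans (coeff-L₀ K) (cases ((n∷ ∷ []) ≟ᶜ K))
    where
    off : (Tη γ ∣ n) K ≡ 0ℚ → n∷ ∷ [] ≢ K → (- 4ℚ) * δ⟨ n∷ ∷ [] ⟩ K + (Tη γ ∣ n) K ≡ 0ℚ
    off ≡0 n≢K = cong₂ (λ d t → (- 4ℚ) * d + t) (δ-≢ (n∷ ∷ []) K n≢K) ≡0
    cases : Dec (n∷ ∷ [] ≡ K) → (- 4ℚ) * δ⟨ n∷ ∷ [] ⟩ K + (Tη γ ∣ n) K ≡ 0ℚ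
    cases (yes refl) = cong₂ (λ d t → (- 4ℚ) * d + t) (δ-refl (n∷ ∷ [])) (begin
      (Tη γ ∣ n) (n∷ ∷ []) ≡⟨ ∣-yes (Tη γ) (n∷ ∷ []) (+ᵥ-identityʳ n) ⟩
      Tη γ (n∷ ∷ []) ≡⟨ Tη-γ (n∷ ∷ []) ⟩
      2ℚ * (sign ∣ n +ᵥ 0ᵥ ∣ᵥ + - - 1ℚ) ≡⟨ cong (λ s → 2ℚ * (s + - - 1ℚ)) (trans (cong (sign ∘ ∣_∣ᵥ) (+ᵥ-identityʳ n)) (sign-even ∣ n ∣ᵥ even)) ⟩
      4ℚ ∎)
    cases (no n≢K) with admissible? k K | deg K ≟ᵥ n
    ... | yes adm | _ = off (Tη-γ∣-admissible k n≤k K adm) n≢K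
    ... | no _ | no deg≢n = off (∣-no (Tη γ) K deg≢n) n≢K
    ... | no ¬adm | yes deg≡n = ⊥-elim (¬P (¬adm , deg≡n , n≢K))

  L≗ : coeff L ≗ Tη (coeff z)
  L≗ K = begin
    coeff L K ≡⟨ filter-≈ P? L₀ vanishes K ⟩
    coeff L₀ K ≡⟨ coeff-L₀ K ⟩
    (- 4ℚ) * δ⟨ n∷ ∷ [] ⟩ K + (Tη γ ∣ n) K ≡⟨ solve 2 (λ s t → s :+ t := con 1ℚ :* t :+ s) refl ((- 4ℚ) * δ⟨ n∷ ∷ [] ⟩ K) ((Tη γ ∣ n) K) ⟩
    1ℚ * (Tη γ ∣ n) K + (- 4ℚ) * δ⟨ n∷ ∷ [] ⟩ K
      ≡⟨ cong₂ (λ s t → 1ℚ * s + (- 4ℚ) * t) (trans (sym (W-∣ 2ℚ 1ℚ γ n K)) (sym (W-cong 2ℚ 1ℚ (coeff-restrict γ n) K))) (sym (Tη-Υ^ (n∷ ∷ []) K)) ⟩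
    1ℚ * Tη (coeff G) K + (- 4ℚ) * Tη (coeff (Υ^ (n∷ ∷ []))) K ≡⟨ W-linear 2ℚ 1ℚ 1ℚ (- 4ℚ) (coeff G) (coeff (Υ^ (n∷ ∷ []))) K ⟨
    Tη (λ J → 1ℚ * coeff G J + (- 4ℚ) * coeff (Υ^ (n∷ ∷ [])) J) K
      ≡⟨ W-cong 2ℚ 1ℚ (λ J → trans (coeff-z J) (cong (_+ (- 4ℚ) * coeff (Υ^ (n∷ ∷ [])) J) (sym (*-identityˡ (coeff G J))))) K ⟨
    Tη (coeff z) K ∎

  Υ∈ : ∀ I → P I → InIdeal (IOgen k) (Υ^ I)
  Υ∈ I (¬adm , deg≡n , n≢I) with inadmissible⇒EvenPart k I ¬adm
  ... | evenPart I′ b I″ refl b≤k b-even = Υ^-part∈ (InIdeal-isIdeal (IOgen k)) I′ b I″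
    (Υ^∈⟨IOgen⟩ k m b (ℕ.<-≤-trans (part-smaller I′ b n∷ I″ deg≡n (n≢I ∘ sym)) ∣n∣≤m) b≤k b-even)

  z∈ : InIdeal (IOgen k) z
  z∈ = resp-≈ {L >>= Υ^} {z} (Υ-expansion L z L≗) (>>=-closed {L} {Υ^} (All.map (λ {qI} → Υ∈ (proj₂ qI)) (all-filter (P? ∘ proj₂) L₀)))

Υgen⊆⟨IOgen⟩ : (k : Vec ℕ∞ ℓ) → ∀ {x} → Υgen k x → InIdeal (IOgen k) x
Υgen⊆⟨IOgen⟩ k {x} (n , n≤k , even , isΥ) = IsIdeal.resp-≈ (InIdeal-isIdeal (IOgen k)) {Υ^ (n ∷ [])} {x} (isΥ-unique (n ∷ []) {x} isΥ) (Υ^∈⟨IOgen⟩ k _ n ℕ.≤-refl n≤k even)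

-- Tensors

apply₂ : Functional ℓ → Functional ℓ → Lin₂ ℓ → ℚ
apply₂ φ ψ t = ∑ (λ s → proj₁ s * φ (proj₁ (proj₂ s)) * ψ (proj₂ (proj₂ s))) t

contractˡ contractʳ : Functional ℓ → Lin₂ ℓ → Lin ℓ
contractˡ φ = map λ (q , I , J) → (q * φ I , J)
contractʳ ψ = map λ (q , I , J) → (q * ψ J , I)

apply-contractˡ : (φ ψ : Functional ℓ) → ∀ t → apply ψ (contractˡ φ t) ≡ apply₂ φ ψ t
apply-contractˡ φ ψ t = ∑-map _ _ t

apply-contractʳ : (φ ψ : Functional ℓ) → ∀ t → apply φ (contractʳ ψ t) ≡ apply₂ φ ψ t
apply-contractʳ φ ψ t = trans (∑-map _ _ t) (∑-cong (λ (q , I , J) → solve 3 (λ q a b → q :* b :* a := q :* a :* b) refl q (φ I) (ψ J)) t)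

-- Contracting one tensor factor leaves an element of `Lin`, so independence of the representing
-- list follows from two uses of `apply-≈`.
apply₂-≈₂ : (φ ψ : Functional ℓ) → ∀ {s t} → s ≈₂ t → apply₂ φ ψ s ≡ apply₂ φ ψ t
apply₂-≈₂ φ ψ {s} {t} s≈t = begin
  apply₂ φ ψ s ≡⟨ apply-contractʳ φ ψ s ⟨
  apply φ (contractʳ ψ s) ≡⟨ apply-≈ φ {contractʳ ψ s} {contractʳ ψ t} (λ I → begin
    coeff (contractʳ ψ s) I ≡⟨ apply-contractʳ (δᶜ I) ψ s ⟩
    apply₂ (δᶜ I) ψ s ≡⟨ apply-contractˡ (δᶜ I) ψ s ⟨
    apply ψ (contractˡ (δᶜ I) s) ≡⟨ apply-≈ ψ {contractˡ (δᶜ I) s} {contractˡ (δᶜ I) t} (λ J → trans (apply-contractˡ (δᶜ I) (δᶜ J) s) (trans (s≈t I J) (sym (apply-contractˡ (δᶜ I) (δᶜ J) t)))) ⟩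
    apply ψ (contractˡ (δᶜ I) t) ≡⟨ apply-contractˡ (δᶜ I) ψ t ⟩
    apply₂ (δᶜ I) ψ t ≡⟨ apply-contractʳ (δᶜ I) ψ t ⟨
    coeff (contractʳ ψ t) I ∎) ⟩
  apply φ (contractʳ ψ t) ≡⟨ apply-contractʳ φ ψ t ⟩
  apply₂ φ ψ t ∎

apply₂-Δ : (φ ψ : Functional ℓ) → ∀ h → apply₂ φ ψ (Δ h) ≡ apply (φ ⋆ ψ) h
apply₂-Δ φ ψ h = trans (∑-concatMap _ _ h) (∑-cong (λ (q , I) → begin
  apply₂ φ ψ (map (λ ps → (q , proj₁ ps , proj₂ ps)) (splits I)) ≡⟨ ∑-map _ _ (splits I) ⟩
  ∑ (λ (J , K) → q * φ J * ψ K) (splits I) ≡⟨ ∑-cong (λ (J , K) → *-assoc q (φ J) (ψ K)) (splits I) ⟩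
  ∑ (λ (J , K) → q * (φ J * ψ K)) (splits I) ≡⟨ ∑-*ˡ q _ (splits I) ⟩
  q * (φ ⋆ ψ) I ∎) h)

apply₂-⊗ : (φ ψ : Functional ℓ) → ∀ x y → apply₂ φ ψ (x ⊗ y) ≡ apply φ x * apply ψ y
apply₂-⊗ φ ψ [] y = sym (*-zeroˡ (apply ψ y))
apply₂-⊗ φ ψ ((p , P) ∷ x) y = begin
  apply₂ φ ψ (map (λ qJ → (p * proj₁ qJ , P , proj₂ qJ)) y ++ (x ⊗ y))
    ≡⟨ ∑-++ _ (map (λ qJ → (p * proj₁ qJ , P , proj₂ qJ)) y) (x ⊗ y) ⟩
  apply₂ φ ψ (map (λ qJ → (p * proj₁ qJ , P , proj₂ qJ)) y) + apply₂ φ ψ (x ⊗ y)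
    ≡⟨ cong₂ _+_ monomial (apply₂-⊗ φ ψ x y) ⟩
  p * φ P * apply ψ y + apply φ x * apply ψ y
    ≡⟨ *-distribʳ-+ (apply ψ y) (p * φ P) (apply φ x) ⟨
  apply φ ((p , P) ∷ x) * apply ψ y ∎
  where
  monomial : apply₂ φ ψ (map (λ qJ → (p * proj₁ qJ , P , proj₂ qJ)) y) ≡ p * φ P * apply ψ y
  monomial = begin
    apply₂ φ ψ (map (λ qJ → (p * proj₁ qJ , P , proj₂ qJ)) y) ≡⟨ ∑-map _ _ y ⟩
    ∑ (λ (q , J) → p * q * φ P * ψ J) y ≡⟨ ∑-cong (λ (q , J) → solve 4 (λ p q a b → p :* q :* a :* b := p :* a :* (q :* b)) refl p q (φ P) (ψ J)) y ⟩
    ∑ (λ (q , J) → p * φ P * (q * ψ J)) y ≡⟨ ∑-*ˡ (p * φ P) _ y ⟩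
    p * φ P * apply ψ y ∎

ΣLin₂ : List (QSym ℓ × QSym ℓ) → Lin₂ ℓ
ΣLin₂ = foldr (λ cd acc → (proj₁ cd ⊗ proj₂ cd) ++ acc) []

apply₂-ΣLin₂ : (φ ψ : Functional ℓ) → ∀ L → apply₂ φ ψ (ΣLin₂ L) ≡ ∑ (λ (c , d) → apply φ c * apply ψ d) L
apply₂-ΣLin₂ φ ψ [] = refl
apply₂-ΣLin₂ φ ψ ((c , d) ∷ L) = trans (∑-++ _ (c ⊗ d) (ΣLin₂ L)) (cong₂ _+_ (apply₂-⊗ φ ψ c d) (apply₂-ΣLin₂ φ ψ L))

∑-All-zero : {f : A → ℚ} → ∀ {xs} → All (λ x → f x ≡ 0ℚ) xs → ∑ f xs ≡ 0ℚ
∑-All-zero [] = refl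
∑-All-zero (fx≡0 ∷ rest) = cong₂ _+_ fx≡0 (∑-All-zero rest)

-- The span of the admissible η_I

η∈ : (k : Vec ℕ∞ ℓ) → ∀ {I} → Admissible k I → ηSpan k (WLin 2ℚ 1ℚ I)
η∈ k {I} adm = (1ℚ , I) ∷ [] , adm ∷ [] , λ J → begin
  coeff (WLin 2ℚ 1ℚ I) J ≡⟨ apply-WLin 2ℚ 1ℚ (δᶜ J) I ⟩
  Tη (δᶜ J) I ≡⟨ Tη-δᶜ I J ⟩
  ηcoef I J ≡⟨ trans (+-identityʳ _) (*-identityˡ (ηcoef I J)) ⟨
  1ℚ * ηcoef I J + 0ℚ ∎

splits-All : {P : NZ ℓ → Set} → ∀ {I} → All P I → All (λ ps → All P (proj₁ ps) × All P (proj₂ ps)) (splits I)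
splits-All [] = ([] , []) ∷ []
splits-All (pa ∷ pI) = ([] , pa ∷ pI) ∷ map⁺ (All.map (λ (pJ , pK) → pa ∷ pJ , pK) (splits-All pI))

ηSpan-·ₛ : (k : Vec ℕ∞ ℓ) → ∀ c {x} → ηSpan k x → ηSpan k (c ·ₛ x)
ηSpan-·ₛ k c {x} (L , adm , x≡) = c ·ₛ L , map⁺ adm , λ J → trans (apply-·ₛ (δᶜ J) c x) (trans (cong (c *_) (x≡ J)) (sym (apply-·ₛ (λ I → ηcoef I J) c L)))

-- Each η_I is homogeneous of degree `deg I`, so a component of `x` is obtained by selecting terms
-- of its expansion.
ηSpan-component : (k : Vec ℕ∞ ℓ) → ∀ x n → ηSpan k x → ηSpan k (component n x)
ηSpan-component k x n (L , adm , x≡) = component n L , map⁺ adm , λ J → begin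
  coeff (component n x) J ≡⟨ apply-component (δᶜ J) n x ⟩
  apply (δᶜ J ∣ n) x ≡⟨ apply-η (δᶜ J ∣ n) x L x≡ ⟩
  apply (Tη (δᶜ J ∣ n)) L ≡⟨ apply-cong (W-∣ 2ℚ 1ℚ (δᶜ J) n) L ⟩
  apply (Tη (δᶜ J) ∣ n) L ≡⟨ apply-component (Tη (δᶜ J)) n L ⟨
  apply (Tη (δᶜ J)) (component n L) ≡⟨ apply-cong (λ I → Tη-δᶜ I J) (component n L) ⟩
  apply (λ I → ηcoef I J) (component n L) ∎

-- The coefficient of `Δ x` at a pair is the value at `x` of a convolution of indicators. `W-⋆`
-- turns this into deconcatenation of the η_I, and both pieces of an admissible composition are
-- admissible.
ηSpan-coalgebra : (k : Vec ℕ∞ ℓ) → ∀ x → ηSpan k x → InTensor (ηSpan k) (Δ x)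
ηSpan-coalgebra {ℓ} k x (L , adm , x≡) = concatMap factors L , members adm , λ J K → begin
  coeff₂ (Δ x) J K ≡⟨ apply₂-Δ (δᶜ J) (δᶜ K) x ⟩
  apply (δᶜ J ⋆ δᶜ K) x ≡⟨ apply-η (δᶜ J ⋆ δᶜ K) x L x≡ ⟩
  apply (Tη (δᶜ J ⋆ δᶜ K)) L ≡⟨ apply-cong (W-⋆ 2ℚ 1ℚ (δᶜ J) (δᶜ K)) L ⟩
  apply (Tη (δᶜ J) ⋆ Tη (δᶜ K)) L ≡⟨ ∑-cong (λ (q , I) → sym (factors-sum J K q I)) L ⟩
  ∑ (λ qI → ∑ (λ (c , d) → coeff c J * coeff d K) (factors qI)) L ≡⟨ ∑-concatMap _ factors L ⟨
  ∑ (λ (c , d) → coeff c J * coeff d K) (concatMap factors L) ≡⟨ apply₂-ΣLin₂ (δᶜ J) (δᶜ K) (concatMap factors L) ⟨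
  coeff₂ (ΣLin₂ (concatMap factors L)) J K ∎
  where
  factors : ℚ × Comp ℓ → List (QSym ℓ × QSym ℓ)
  factors (q , I) = map (λ ps → (q ·ₛ WLin 2ℚ 1ℚ (proj₁ ps) , WLin 2ℚ 1ℚ (proj₂ ps))) (splits I)
  factors-sum : ∀ J K q I → ∑ (λ (c , d) → coeff c J * coeff d K) (factors (q , I)) ≡ q * (Tη (δᶜ J) ⋆ Tη (δᶜ K)) I
  factors-sum J K q I = begin
    ∑ (λ (c , d) → coeff c J * coeff d K) (factors (q , I))
      ≡⟨ ∑-map _ _ (splits I) ⟩
    ∑ (λ (I′ , I″) → coeff (q ·ₛ WLin 2ℚ 1ℚ I′) J * coeff (WLin 2ℚ 1ℚ I″) K) (splits I)
      ≡⟨ ∑-cong (λ (I′ , I″) → trans (cong₂ _*_ (trans (apply-·ₛ (δᶜ J) q (WLin 2ℚ 1ℚ I′)) (cong (q *_) (apply-WLin 2ℚ 1ℚ (δᶜ J) I′))) (apply-WLin 2ℚ 1ℚ (δᶜ K) I″))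
           (*-assoc q (Tη (δᶜ J) I′) (Tη (δᶜ K) I″))) (splits I) ⟩
    ∑ (λ (I′ , I″) → q * (Tη (δᶜ J) I′ * Tη (δᶜ K) I″)) (splits I)
      ≡⟨ ∑-*ˡ q _ (splits I) ⟩
    q * (Tη (δᶜ J) ⋆ Tη (δᶜ K)) I ∎
  members : ∀ {L} → All (λ qI → Admissible k (proj₂ qI)) L → All (λ cd → ηSpan k (proj₁ cd) × ηSpan k (proj₂ cd)) (concatMap factors L)
  members [] = []
  members {(q , I) ∷ _} (adm ∷ adms) = ++⁺
    (map⁺ (All.map (λ {ps} (adm′ , adm″) → ηSpan-·ₛ k q {WLin 2ℚ 1ℚ (proj₁ ps)} (η∈ k adm′) , η∈ k adm″) (splits-All adm)))
    (members adms)

ηSpan-isGradedSubcoalgebra : (k : Vec ℕ∞ ℓ) → IsGradedSubcoalgebra (ηSpan k)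
ηSpan-isGradedSubcoalgebra k = record
  { respects≈ = λ x y x≈y (L , adm , x≡) → L , adm , λ J → trans (sym (x≈y J)) (x≡ J)
  ; zero∈ = [] , [] , λ _ → refl
  ; ⊕-closed = λ x y (L , adm , x≡) (L′ , adm′ , y≡) → L ++ L′ , ++⁺ adm adm′ ,
      λ J → trans (apply-++ (δᶜ J) x y) (trans (cong₂ _+_ (x≡ J) (y≡ J)) (sym (apply-++ (λ I → ηcoef I J) L L′)))
  ; ·ₛ-closed = λ c x → ηSpan-·ₛ k c {x}
  ; graded = ηSpan-component k
  ; coalgebra = ηSpan-coalgebra k
  }

homogeneous-component : ∀ n (h : QSym ℓ) → Homogeneous n h → h ≈ component n h
homogeneous-component n h hom K = sym (trans (coeff-component n h K) (cases (deg K ≟ᵥ n)))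
  where
  cases : Dec (deg K ≡ n) → (coeff h ∣ n) K ≡ coeff h K
  cases (yes deg≡n) = ∣-yes (coeff h) K deg≡n
  -- `Homogeneous` only speaks of nonzero coefficients; decidable equality on `ℚ` converts this into
  -- vanishing off degree `n`.
  cases (no deg≢n) = trans (∣-no (coeff h) K deg≢n) (sym (decidable-stable (coeff h K ℚ.≟ 0ℚ) (deg≢n ∘ hom K)))

component-homogeneous : ∀ n (h : QSym ℓ) → Homogeneous n (component n h)
component-homogeneous n h K ≢0 = decidable-stable (deg K ≟ᵥ n) λ deg≢n → ≢0 (trans (coeff-component n h K) (∣-no (coeff h) K deg≢n))

-- The expansion of a homogeneous `h` may list terms of other degrees that cancel, on which `γ` need
-- not vanish. Passing to the degree `n` component makes each term vanish by itself.
ηSpan-OCondition : (k : Vec ℕ∞ ℓ) → OCondition k (ηSpan k)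
ηSpan-OCondition k h n (L , adm , h≡) n≤k hom = a-b≡0⇒a≡b _ _ (begin
  apply ζ̄Q h + (- 1ℚ) * apply (ζQ ⁻¹⋆) h ≡⟨ apply-γ h ⟨
  apply γ h ≡⟨ apply-≈ γ {h} {component n h} (homogeneous-component n h hom) ⟩
  apply γ (component n h) ≡⟨ apply-component γ n h ⟩
  apply (γ ∣ n) h ≡⟨ apply-η (γ ∣ n) h L h≡ ⟩
  apply (Tη (γ ∣ n)) L ≡⟨ apply-cong (W-∣ 2ℚ 1ℚ γ n) L ⟩
  apply (Tη γ ∣ n) L ≡⟨ ∑-All-zero (All.map (λ {qI} adm → trans (cong (proj₁ qI *_) (Tη-γ∣-admissible k n≤k (proj₂ qI) adm)) (*-zeroʳ (proj₁ qI))) adm) ⟩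
  0ℚ ∎)

-- Maximality

Annihilates : (QSym ℓ → Set) → NSym ℓ → Set
Annihilates C x = ∀ h → C h → apply (coeff x) h ≡ 0ℚ

apply-· : (x y : NSym ℓ) → ∀ h L → Δ h ≈₂ ΣLin₂ L → apply (coeff (x · y)) h ≡ ∑ (λ (c , d) → apply (coeff x) c * apply (coeff y) d) L
apply-· x y h L Δh≈ = begin
  apply (coeff (x · y)) h ≡⟨ apply-cong (coeff-· x y) h ⟩
  apply (coeff x ⋆ coeff y) h ≡⟨ apply₂-Δ (coeff x) (coeff y) h ⟨
  apply₂ (coeff x) (coeff y) (Δ h) ≡⟨ apply₂-≈₂ (coeff x) (coeff y) {Δ h} {ΣLin₂ L} Δh≈ ⟩
  apply₂ (coeff x) (coeff y) (ΣLin₂ L) ≡⟨ apply₂-ΣLin₂ (coeff x) (coeff y) L ⟩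
  ∑ (λ (c , d) → apply (coeff x) c * apply (coeff y) d) L ∎

-- Pairing a product with `h` sums products of pairings over a decomposition of `Δ h` with both
-- factors in `C`; in each term one pairing is zero.
annihilator-isIdeal : {C : QSym ℓ → Set} → IsGradedSubcoalgebra C → IsIdeal (Annihilates C)
annihilator-isIdeal {C = C} sub = record
  { resp-≈ = λ {x} {y} x≈y x⊥ h h∈C → trans (sym (apply-cong x≈y h)) (x⊥ h h∈C)
  ; []-closed = λ h _ → apply-zero h
  ; ⊕-closed = λ {x} {y} x⊥ y⊥ h h∈C → begin
      apply (coeff (x ⊕ y)) h ≡⟨ apply-cong (λ J → apply-++ (δᶜ J) x y) h ⟩
      apply (λ J → coeff x J + coeff y J) h ≡⟨ apply-+ (coeff x) (coeff y) h ⟩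
      apply (coeff x) h + apply (coeff y) h ≡⟨ cong₂ _+_ (x⊥ h h∈C) (y⊥ h h∈C) ⟩
      0ℚ ∎
  ; ·-closedˡ = λ z {x} x⊥ h h∈C → let (L , L⊆C , Δh≈) = coalgebra h h∈C in
      trans (apply-· z x h L Δh≈) (∑-All-zero (All.map (λ {cd} (_ , d∈C) → trans (cong (apply (coeff z) (proj₁ cd) *_) (x⊥ _ d∈C)) (*-zeroʳ (apply (coeff z) (proj₁ cd)))) L⊆C))
  ; ·-closedʳ = λ z {x} x⊥ h h∈C → let (L , L⊆C , Δh≈) = coalgebra h h∈C in
      trans (apply-· x z h L Δh≈) (∑-All-zero (All.map (λ {cd} (c∈C , _) → trans (cong (_* apply (coeff z) (proj₂ cd)) (x⊥ _ c∈C)) (*-zeroˡ (apply (coeff z) (proj₂ cd)))) L⊆C))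
  }
  where open IsGradedSubcoalgebra sub

-- A generator of degree `n` sees only the degree `n` component of `h`. Gradedness keeps that
-- component in `C`, where the condition on homogeneous elements applies.
IOgen⊆annihilator : (k : Vec ℕ∞ ℓ) {C : QSym ℓ → Set} → IsGradedSubcoalgebra C → OCondition k C → ∀ {x} → IOgen k x → Annihilates C x
IOgen⊆annihilator k sub cond {x} (n , n≤k , x≡γ∣n) h h∈C = begin
  apply (coeff x) h ≡⟨ apply-cong x≡γ∣n h ⟩
  apply (γ ∣ n) h ≡⟨ apply-component γ n h ⟨
  apply γ h′ ≡⟨ apply-γ h′ ⟩
  apply ζ̄Q h′ + (- 1ℚ) * apply (ζQ ⁻¹⋆) h′ ≡⟨ cong (_+ (- 1ℚ) * apply (ζQ ⁻¹⋆) h′) (cond h′ n (IsGradedSubcoalgebra.graded sub h n h∈C) n≤k (component-homogeneous n h)) ⟩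
  apply (ζQ ⁻¹⋆) h′ + (- 1ℚ) * apply (ζQ ⁻¹⋆) h′ ≡⟨ solve 1 (λ a → a :+ (:- con 1ℚ) :* a := con 0ℚ) refl (apply (ζQ ⁻¹⋆) h′) ⟩
  0ℚ ∎
  where
  h′ : QSym _
  h′ = component n h

ηSpan-maximal : (k : Vec ℕ∞ ℓ) (C : QSym ℓ → Set) → IsGradedSubcoalgebra C → OCondition k C → ∀ h → C h → ηSpan k h
ηSpan-maximal {ℓ} k C sub cond h h∈C = L , all-filter (admissible? k ∘ proj₂) L₀ , λ J → begin
  coeff h J ≡⟨ apply-cong (Sη-Tη (δᶜ J)) h ⟨
  apply (Sη (Tη (δᶜ J))) h ≡⟨ expand (Tη (δᶜ J)) ⟨
  apply (Tη (δᶜ J)) L₀ ≡⟨ apply-≈ (Tη (δᶜ J)) {L} {L₀} (filter-≈ (admissible? k) L₀ vanishes) ⟨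
  apply (Tη (δᶜ J)) L ≡⟨ apply-cong (λ I → Tη-δᶜ I J) L ⟩
  apply (λ I → ηcoef I J) L ∎
  where
  L₀ L : Lin ℓ
  -- The η-coordinates of `h`: the one at `K` is the pairing with Υ^K, hence zero for inadmissible
  -- `K`, and the filter retains the rest.
  L₀ = h >>= WLin ½ (- ½)
  L = filter (admissible? k ∘ proj₂) L₀
  expand : ∀ φ → apply φ L₀ ≡ apply (Sη φ) h
  expand φ = trans (apply->>= φ h (WLin ½ (- ½))) (apply-cong (apply-WLin ½ (- ½) φ) h)
  annihilator : IsIdeal (Annihilates C)
  annihilator = annihilator-isIdeal sub
  Υ⊥ : ∀ K → ¬ Admissible k K → Annihilates C (Υ^ K)
  Υ⊥ K ¬adm with inadmissible⇒EvenPart k K ¬adm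
  ... | evenPart I′ b I″ refl b≤k even = Υ^-part∈ annihilator I′ b I″
    (InIdeal-least (IOgen k) annihilator (λ {x} → IOgen⊆annihilator k sub cond {x}) {Υ^ (b ∷ [])} (Υ^∈⟨IOgen⟩ k _ b ℕ.≤-refl b≤k even))
  vanishes : ∀ K → ¬ Admissible k K → coeff L₀ K ≡ 0ℚ
  vanishes K ¬adm = begin
    coeff L₀ K ≡⟨ expand (δᶜ K) ⟩
    apply (Sη (δᶜ K)) h ≡⟨ apply-cong (λ I → trans (W-cong ½ (- ½) (λ J → δ-sym J K) I) (sym (coeff-Υ^ K I))) h ⟩
    apply (coeff (Υ^ K)) h ≡⟨ Υ⊥ K ¬adm h h∈C ⟩
    0ℚ ∎

theorem5p18 : ∀ (ℓ : ℕ) → 1 ≤ ℓ → (k : Vec ℕ∞ ℓ) →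
    SameIdeal (IOgen k) (Υgen k)
    × (IsGradedSubcoalgebra (ηSpan k)
    × OCondition k (ηSpan k)
    × (∀ (C : QSym ℓ → Set) → IsGradedSubcoalgebra C → OCondition k C →
    ∀ h → C h → ηSpan k h))
theorem5p18 ℓ _ k =
  (λ x → mk⇔
    (InIdeal-least (IOgen k) (InIdeal-isIdeal (Υgen k)) (λ {g} → IOgen⊆⟨Υgen⟩ k {g}) {x})
    (InIdeal-least (Υgen k) (InIdeal-isIdeal (IOgen k)) (λ {g} → Υgen⊆⟨IOgen⟩ k {g}) {x})) ,
  ηSpan-isGradedSubcoalgebra k ,
  ηSpan-OCondition k ,
  ηSpan-maximal k
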